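{- Let $w_1$ be the weight system of height $1$ on the lecture hall graph defined by \[ w_1(0;i,j)=\frac{q^j(1-abq^{i+1})(1-aq^{i+1})}{(1-abq^{i+j+1})(1-abq^{i+j+2})}\qquad(0\le j\le i) \] (and $w_1(t;i,j)=0$ for $t\ge1$). Then the mixed moments $\sigma^L_{n,k}(a,b;q)$ of the little $q$-Jacobi polynomials satisfy \[ \sigma^L_{n,k}(a,b;q)=h^{w_1}_{n,k}\qquad(n\ge k\ge0). \]
   Context: Lecture hall graph. For integers $t\ge0$, $0\le j\le i$ put $v^t_{i,j}=(i,\,t+\frac{j}{i+1})$, and set $v^t_{i,i+1}:=v^{t+1}_{i,0}$. The vertices of the lecture hall graph are all $v^t_{i,j}$; its edges join $v^t_{i,j}$ with $v^t_{i,j+1}$ (vertical edges) and $v^t_{i,j}$ with $v^t_{i+1,j}$, for $t\ge 0$, $0\le j\le i$. An east step is a directed edge $(v^t_{i,j},v^t_{i+1,j})$; a south step is a vertical edge directed downwards, $(v^t_{i,j+1},v^t_{i,j})$. A weight system $w$ assigns a weight $w(t;i,j)$ to each east step $(v^t_{i,j},v^t_{i+1,j})$; its height is the smallest integer $\ell$ with $w(t;i,j)=0$ for all $t\ge\ell$. The weight $w(p)$ of a path is the product of the weights of its east steps. $\mathrm{SE}((k,\infty)\to(n,0))$ is the set of paths $(\dots,v_2,v_1,v_0)$ with $v_0=(n,0)$, $\lim_{m\to\infty}v_m=(k,\infty)$, and each $(v_{m+1},v_m)$ a south or east step. Define $h^w_{n,k}=\sum_{p\in \mathrm{SE}((k,\infty)\to(n,0))}w(p)$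 (so $h^w_{n,n}=1$). Little $q$-Jacobi polynomials. The monic little $q$-Jacobi polynomials are \[ p_n(x;a,b;q)=\frac{(aq;q)_n}{(-1)^nq^{ -\binom n2}(abq^{n+1};q)_n}\;{}_2\phi_1\!\left(\begin{matrix} q^{ -n},\, abq^{n+1} \\ aq \end{matrix};q,qx\right), \] where ${}_2\phi_1(\alpha_1,\alpha_2;\beta;q,z)=\sum_{k\ge0}\frac{(\alpha_1;q)_k(\alpha_2;q)_k}{(q;q)_k(\beta;q)_k}z^k$ and $(z;q)_k=\prod_{i=0}^{k-1}(1-zq^i)$. The mixed moments are defined by $x^n=\sum_{k=0}^n\sigma^L_{n,k}(a,b;q)\,p_k(x;a,b;q)$. Here $a,b,q$ are indeterminates. -}

module Defs where

open import Level using (Level; _⊔_)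
open import Algebra.Apartness.Bundles using (HeytingField; HeytingCommutativeRing)
open import Algebra.Bundles using (CommutativeRing)
open import Data.Nat.Base as ℕ using (ℕ; zero; suc)
import Data.Nat.Properties as ℕ
open import Data.Nat.Combinatorics using (_C_)
open import Data.Integer.Base using (+_)
open import Data.Rational.Unnormalised.Base as ℚᵘ using (ℚᵘ; _/_)
open import Data.Fin.Base using (Fin; zero; suc; toℕ; fromℕ<; inject₁)
open import Data.List.Base using (List; foldr)
open import Data.List.Relation.Unary.Unique.Setoid using (Unique)
import Data.List.Membership.Setoid as Membership
open import Data.Product.Base using (∃; ∃-syntax; _,_; proj₁; proj₂)
open import Relation.Binary.Bundles using (Setoid)
open import Relation.Binary.PropositionalEquality.Core as ≡ using (_≡_; _≢_)
open import Relation.Nullary.Decidable using (yes; no)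

------------------------------------------------------------------------
-- The lecture hall graph

-- v t i j is v^t_{i,j}; every vertex has exactly one such representation
-- with 0 ≤ j ≤ i.

record Vertex : Set where
  constructor v
  field
    level  : ℕ
    column : ℕ
    index  : Fin (suc column)

open Vertex public

height : Vertex → ℚᵘ
height (v t i j) = (+ t / 1) ℚᵘ.+ (+ toℕ j / suc i)

-- v^t_{i,j+1}, which for j = i is by convention v^{t+1}_{i,0}.

above : Vertex → Vertex
above (v t i j) with suc (toℕ j) ℕ.<? suc i
... | yes 1+j≤i = v t i (fromℕ< 1+j≤i)
... | no  _     = v (suc t) i zero

right : Vertex → Vertex
right (v t i j) = v t (suc i) (inject₁ j)

data Step (u u′ : Vertex) : Set where
  east  : u′ ≡ right u → Step u u′
  south : u ≡ above u′ → Step u u′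

-- Infinite paths (…, v₂, v₁, v₀), indexed from their endpoint v₀, which come
-- from (k, ∞).  Columns are integers, so convergence of the first coordinate
-- to k means that it is eventually equal to k.

record SE (k : ℕ) (end : Vertex) : Set where
  field
    vertex   : ℕ → Vertex
    vertex-0 : vertex 0 ≡ end
    step     : ∀ m → Step (vertex (suc m)) (vertex m)
    column→k : ∃[ M ] (∀ m → M ℕ.≤ m → column (vertex m) ≡ k)
    height→∞ : ∀ (B : ℕ) →
               ∃[ M ] (∀ m → M ℕ.≤ m → (+ B / 1) ℚᵘ.≤ height (vertex m))

SE-setoid : ℕ → Vertex → Setoid _ _
SE-setoid k end = record
  { Carrier       = SE k end
  ; _≈_           = λ p p′ → ∀ m → SE.vertex p m ≡ SE.vertex p′ m
  ; isEquivalence = record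
    { refl  = λ _ → ≡.refl
    ; sym   = λ e m → ≡.sym (e m)
    ; trans = λ e e′ m → ≡.trans (e m) (e′ m)
    }
  }

module FieldNotation {c ℓ₁ ℓ₂ : Level} (K : HeytingField c ℓ₁ ℓ₂) where

  open HeytingField K public hiding (zero)
  open CommutativeRing
    (HeytingCommutativeRing.commutativeRing heytingCommutativeRing) public
    using (ring; semiring; +-commutativeMonoid; *-commutativeMonoid)
  open import Algebra.Properties.Semiring.Exp semiring public
    using (_^_; ^-homo-*)
  open import Algebra.Properties.CommutativeMonoid.Sum +-commutativeMonoid public
    using (sum; sum⁺-syntax)
  open import Algebra.Properties.CommutativeMonoid.Sum *-commutativeMonoid public
    using () renaming (sum to product)
  open import Algebra.Apartness.Properties.HeytingCommutativeRing
    heytingCommutativeRing public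

  product-syntax : ∀ n → (Fin n → Carrier) → Carrier
  product-syntax _ = product

  infixl 10 product-syntax
  syntax product-syntax n (λ i → x) = ∏[ i < n ] x

  -- #⇒invertible inverts y - 0#, which is y up to ≈.
  inv : ∀ {y} → y # 0# → Carrier
  inv y#0 = proj₁ (#⇒invertible y#0)

  infixl 7 _÷_[_]

  _÷_[_] : (x y : Carrier) → y # 0# → Carrier
  x ÷ y [ y#0 ] = x * inv y#0

  inv#0 : ∀ {y} (y#0 : y # 0#) → inv y#0 # 0#
  inv#0 y#0 with #⇒invertible y#0
  ... | y⁻¹ , _ , yy⁻¹≈1 =
    invertibleˡ⇒# (_ , trans (*-congˡ (x-0≈x y⁻¹)) yy⁻¹≈1)

  1#x⇒1-x#0 : ∀ {x} → 1# # x → 1# - x # 0#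
  1#x⇒1-x#0 1#x with #⇒invertible 1#x
  ... | y , y[1-x]≈1 , _ =
    invertibleˡ⇒# (y , trans (*-congˡ (x-0≈x _)) y[1-x]≈1)

  -1#0 : - 1# # 0#
  -1#0 = invertibleˡ⇒# (- 1# , trans (*-congˡ (x-0≈x _)) -1*-1≈1)
    where
    open import Algebra.Properties.Ring ring using (-1*x≈-x; -‿involutive)
    -1*-1≈1 : - 1# * - 1# ≈ 1#
    -1*-1≈1 = trans (-1*x≈-x (- 1#)) (-‿involutive 1#)

  ^#0 : ∀ {x} → x # 0# → ∀ n → x ^ n # 0#
  ^#0 x#0 zero    = 1#0
  ^#0 x#0 (suc n) = x#0y#0→xy#0 x#0 (^#0 x#0 n)

  product#0 : ∀ n (f : Fin n → Carrier) → (∀ i → f i # 0#) → product f # 0#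
  product#0 zero    f f#0 = 1#0
  product#0 (suc n) f f#0 =
    x#0y#0→xy#0 (f#0 zero) (product#0 n (λ i → f (suc i)) (λ i → f#0 (suc i)))

------------------------------------------------------------------------
-- Path weights and h^w_{n,k}

module PathSums {c ℓ₁ ℓ₂ : Level} (K : HeytingField c ℓ₁ ℓ₂) where

  open FieldNotation K

  -- w t i j is the weight w(t;i,j) of the east step leaving v^t_{i,j}.
  WeightSystem : Set c
  WeightSystem = (t i : ℕ) → Fin (suc i) → Carrier

  stepWeight : WeightSystem → ∀ {u u′} → Step u u′ → Carrier
  stepWeight w {u} (east _)  = w (level u) (column u) (index u)
  stepWeight w     (south _) = 1#

  -- From the M of column→k onwards every step is a south step, so the
  -- product over m < M contains all the east steps.
  weight : WeightSystem → ∀ {k end} → SE k end → Carrier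
  weight w p = ∏[ m < proj₁ (SE.column→k p) ] stepWeight w (SE.step p (toℕ m))

  -- s is the sum of f over all of S, where f vanishes outside a finite set.
  record IsFiniteSum {s₁ s₂ : Level} (S : Setoid s₁ s₂)
                     (f : Setoid.Carrier S → Carrier) (s : Carrier)
                     : Set (c ⊔ ℓ₁ ⊔ s₁ ⊔ s₂) where
    open Membership S using (_∉_)
    field
      support : List (Setoid.Carrier S)
      unique  : Unique S support
      outside : ∀ x → x ∉ support → f x ≈ 0#
      value   : foldr (λ x acc → f x + acc) 0# support ≈ s

  -- h^w_{n,k} = s.
  Is-h : WeightSystem → (n k : ℕ) → Carrier → Set (c ⊔ ℓ₁)
  Is-h w n k s = IsFiniteSum (SE-setoid k (v 0 n zero)) (weight w) s

------------------------------------------------------------------------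
-- Little q-Jacobi polynomials

-- The non-degeneracy of a, b, q under which every denominator below is
-- nonzero; it holds when a, b, q are indeterminates, i.e. in a field of
-- rational functions F(a,b,q).

record Generic {c ℓ₁ ℓ₂ : Level} (K : HeytingField c ℓ₁ ℓ₂)
               (a b q : HeytingField.Carrier K) : Set ℓ₂ where
  open FieldNotation K
  field
    q#0    : q # 0#
    1#qᵐ   : ∀ m → 1# # q ^ suc m
    1#aqᵐ  : ∀ m → 1# # a * q ^ suc m
    1#abqᵐ : ∀ m → 1# # a * b * q ^ suc m

module LittleQJacobi {c ℓ₁ ℓ₂ : Level} (K : HeytingField c ℓ₁ ℓ₂)
                     (a b q : HeytingField.Carrier K)
                     (gen : Generic K a b q) where

  open FieldNotation K
  open PathSums K using (WeightSystem)
  open Generic gen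

  -- (z;q)_k
  poch : Carrier → ℕ → Carrier
  poch z k = ∏[ i < k ] (1# - z * q ^ toℕ i)

  poch#0 : ∀ z k → (∀ i → 1# # z * q ^ i) → poch z k # 0#
  poch#0 z k 1#zqⁱ = product#0 k _ (λ i → 1#x⇒1-x#0 (1#zqⁱ (toℕ i)))

  poch-q#0 : ∀ k → poch q k # 0#
  poch-q#0 k = poch#0 q k 1#qᵐ

  poch-aq#0 : ∀ k → poch (a * q) k # 0#
  poch-aq#0 k = poch#0 (a * q) k λ i → #-congˡ (sym (*-assoc a q (q ^ i))) (1#aqᵐ i)

  poch-abqⁿ⁺¹#0 : ∀ n k → poch (a * b * q ^ suc n) k # 0#
  poch-abqⁿ⁺¹#0 n k = poch#0 (a * b * q ^ suc n) k λ i →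
    #-congˡ (trans (*-congˡ (^-homo-* q (suc n) i))
                   (sym (*-assoc (a * b) (q ^ suc n) (q ^ i))))
            (1#abqᵐ (n ℕ.+ i))

  -- Formal power series, given by their coefficients; the polynomials below
  -- are the series with finitely many nonzero coefficients.
  Series : Set c
  Series = ℕ → Carrier

  -- ₂φ₁(α₁,α₂;β;q,z) as a series in z.
  ₂φ₁ : (α₁ α₂ β : Carrier) → (∀ k → poch β k # 0#) → Series
  ₂φ₁ α₁ α₂ β β#0 k =
    (poch α₁ k * poch α₂ k)
      ÷ (poch q k * poch β k) [ x#0y#0→xy#0 (poch-q#0 k) (β#0 k) ]

  -- Substitution of r x for z.
  dilate : Carrier → Series → Series
  dilate r f m = f m * r ^ m

  q⁻¹ : Carrier
  q⁻¹ = inv q#0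

  leadingFactor : ℕ → Carrier
  leadingFactor n =
    poch (a * q) n
      ÷ ((- 1#) ^ n * q⁻¹ ^ (n C 2) * poch (a * b * q ^ suc n) n)
        [ x#0y#0→xy#0 (x#0y#0→xy#0 (^#0 -1#0 n) (^#0 (inv#0 q#0) (n C 2)))
                      (poch-abqⁿ⁺¹#0 n n) ]

  -- p_n(x;a,b;q) as a series in x.  The ₂φ₁ terminates: for m > n the factor
  -- (q^{-n};q)_m contains 1 - q^{-n} q^n.
  p : ℕ → Series
  p n m = leadingFactor n
    * dilate q (₂φ₁ (q⁻¹ ^ n) (a * b * q ^ suc n) (a * q) poch-aq#0) m

  x^ : ℕ → Series
  x^ n m with n ℕ.≟ m
  ... | yes _ = 1#
  ... | no  _ = 0#

  -- x^n = Σ_{k ≤ n} σ n k p_k(x) for all n; σ n k is irrelevant for k > n.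
  IsMixedMoments : (ℕ → ℕ → Carrier) → Set ℓ₁
  IsMixedMoments σ =
    ∀ n m → x^ n m ≈ ∑[ k ≤ n ] (σ n (toℕ k) * p (toℕ k) m)

  1-abqᵐ#0 : ∀ m → 1# - a * b * q ^ suc m # 0#
  1-abqᵐ#0 m = 1#x⇒1-x#0 (1#abqᵐ m)

  w₁ : WeightSystem
  w₁ zero i j =
    (q ^ toℕ j * (1# - a * b * q ^ suc i) * (1# - a * q ^ suc i))
      ÷ ((1# - a * b * q ^ suc (i ℕ.+ toℕ j))
          * (1# - a * b * q ^ suc (suc (i ℕ.+ toℕ j))))
        [ x#0y#0→xy#0 (1-abqᵐ#0 (i ℕ.+ toℕ j)) (1-abqᵐ#0 (suc (i ℕ.+ toℕ j))) ]
  w₁ (suc t) i j = 0#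

{-# OPTIONS --safe #-}
module Submission where

-- A path of nonzero weight has all its east steps at height < 1, so its indices
-- at level 0 never exceed k, and h is a finite sum over lattice paths satisfying
-- a Pascal-type recursion.  The recursion has a product solution, which at
-- index 0 is σ_{n,k} = [n choose k]_q (aq^(k+1);q)_(n-k) / (abq^(2k+2);q)_(n-k).
-- The coefficients of p_k are products too, by the ratio of consecutive terms of
-- the ₂φ₁.  Hence Σ_k σ_{n,k} p_k(x) = x^n amounts to a terminating
-- hypergeometric sum, which telescopes.  Since the p_k are monic of degree k,
-- these σ_{n,k} are the only mixed moments.

open import Defs
open import Level using (Level; 0ℓ)
open import Algebra.Apartness.Bundles using (HeytingField; HeytingCommutativeRing)
open import Algebra.Bundles using (CommutativeRing; RawRing)
open import Algebra.Solver.Ring.AlmostCommutativeRing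
  using (fromCommutativeRing; _-Raw-AlmostCommutative⟶_; Induced-equivalence)
open import Data.Empty using (⊥-elim)
open import Data.Fin.Base using (toℕ; fromℕ<)
open import Data.Fin.Properties
  using (toℕ-injective; toℕ-fromℕ; toℕ-fromℕ<; toℕ-inject₁; toℕ<n)
open import Data.Integer.Base using (+_; +≤+)
import Data.Integer.Properties as ℤ
open import Data.List.Base using (List; []; _∷_; map; _++_; foldr)
open import Data.List.Relation.Binary.Disjoint.Setoid using (Disjoint)
open import Data.List.Relation.Unary.All using ([])
open import Data.List.Relation.Unary.AllPairs using ([]; _∷_)
open import Data.List.Relation.Unary.Any as Any using (Any; here)
import Data.List.Relation.Unary.Any.Properties as Any
open import Data.List.Relation.Unary.Unique.Setoid using (Unique)
import Data.List.Relation.Unary.Unique.Setoid.Properties as Unique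
open import Data.Maybe.Base using (just; nothing)
open import Data.Nat.Base as ℕ using (ℕ; zero; suc; _≤_; z≤n; s≤s)
open import Data.Nat.Combinatorics using (_C_; nC1≡n; nCk+nC[k+1]≡[n+1]C[k+1])
import Data.Nat.Properties as ℕ
open import Data.Nat.Tactic.RingSolver using (solve-∀)
open import Data.Product.Base using (∃; _×_; _,_; proj₁; proj₂)
open import Data.Rational.Unnormalised.Base as ℚᵘ using (_/_; *≤*)
import Data.Rational.Unnormalised.Properties as ℚᵘ
open import Data.Sum.Base as Sum using (_⊎_; inj₁; inj₂)
open import Function.Base using (_∘_; id; case_of_)
open import Relation.Binary.Definitions using (WeaklyDecidable)
open import Relation.Binary.PropositionalEquality.Core as ≡ using (_≡_; _≢_)
open import Relation.Nullary.Decidable using (yes; no)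

-- Every closed form is stated with its denominators multiplied out. An inductive step then becomes
-- a polynomial identity in a few letters that stand for powers of q, and surplus factors are
-- cancelled because `Generic` keeps them apart from zero. The recursion does not close on index 0:
-- read backwards, a south step raises the index. The product formula is therefore proved for every
-- starting index j, where it contains the quotient (abq^(k+1);q)_d / (abq^(k+j+1);q)_d, which is 1
-- at j = 0. Paths are infinite, but they are indexed backwards from their endpoint. So induction
-- can run on the bound M after which the column is constantly k, and once column k is reached the
-- path can only be the vertical ray.

-- A ring solver with integer coefficients

-- Formal differences (m , n) ~ m - n serve as coefficients, so that the
-- solver recognises the cancellations x - x ≈ 0#.
module DifferenceSolver {c ℓ} (R : CommutativeRing c ℓ) where

  open CommutativeRing R
  open import Algebra.Properties.Ring ring
    using (-‿+-comm; x[y-z]≈xy-xz; [y-z]x≈yx-zx; -0#≈0#)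
  open import Algebra.Properties.AbelianGroup +-abelianGroup
    using (⁻¹-anti-homo‿-)
  open import Algebra.Properties.CommutativeSemigroup
    (CommutativeRing.+-commutativeSemigroup R)
    using (interchange)
  open import Algebra.Properties.Semiring.Mult semiring
    using (×-homo-+; ×1-homo-*; ×-homo-1)
    renaming (_×_ to _·_)
  open import Relation.Binary.Reasoning.Setoid setoid

  -- Cancels the common part, which leaves one component 0 and gives every integer a single
  -- representative.
  reduce : ℕ × ℕ → ℕ × ℕ
  reduce (m , n) = m ℕ.∸ n , n ℕ.∸ m

  differences : RawRing 0ℓ 0ℓ
  differences = record
    { Carrier = ℕ × ℕ
    ; _≈_     = _≡_
    ; _+_     = λ { (m , n) (m′ , n′) → reduce (m ℕ.+ m′ , n ℕ.+ n′) }
    ; _*_     = λ { (m , n) (m′ , n′) →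
                    reduce (m ℕ.* m′ ℕ.+ n ℕ.* n′ , m ℕ.* n′ ℕ.+ n ℕ.* m′) }
    ; -_      = λ { (m , n) → n , m }
    ; 0#      = 0 , 0
    ; 1#      = 1 , 0
    }

  +-interchange-- : ∀ w x y z → (w + y) - (x + z) ≈ (w - x) + (y - z)
  +-interchange-- w x y z =
    trans (+-congˡ (sym (-‿+-comm x z))) (interchange w y (- x) (- z))

  difference : ℕ × ℕ → Carrier
  difference (m , n) = m · 1# - n · 1#

  difference-cong : ∀ k l m n → k ℕ.+ n ≡ m ℕ.+ l → difference (k , l) ≈ difference (m , n)
  difference-cong k l m n k+n≡m+l = begin
    K - L               ≈⟨ +-identityʳ _ ⟨
    (K - L) + 0#        ≈⟨ +-congˡ (-‿inverseʳ N) ⟨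
    (K - L) + (N - N)   ≈⟨ +-interchange-- K L N N ⟨
    (K + N) - (L + N)   ≈⟨ +-cong K+N≈M+L (-‿cong (+-comm L N)) ⟩
    (M + L) - (N + L)   ≈⟨ +-interchange-- M N L L ⟩
    (M - N) + (L - L)   ≈⟨ +-congˡ (-‿inverseʳ L) ⟩
    (M - N) + 0#        ≈⟨ +-identityʳ _ ⟩
    M - N               ∎
    where
    K = k · 1#
    L = l · 1#
    M = m · 1#
    N = n · 1#
    K+N≈M+L : K + N ≈ M + L
    K+N≈M+L = begin
      K + N             ≈⟨ ×-homo-+ 1# k n ⟨
      (k ℕ.+ n) · 1#    ≡⟨ ≡.cong (_· 1#) k+n≡m+l ⟩
      (m ℕ.+ l) · 1#    ≈⟨ ×-homo-+ 1# m l ⟩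
      M + L             ∎

  difference-reduce : ∀ i → difference (reduce i) ≈ difference i
  difference-reduce (m , n) =
    difference-cong (m ℕ.∸ n) (n ℕ.∸ m) m n (∸-balance m n)
    where
    ∸-balance : ∀ m n → m ℕ.∸ n ℕ.+ n ≡ m ℕ.+ (n ℕ.∸ m)
    ∸-balance m         zero    = ≡.cong (m ℕ.+_) (≡.sym (ℕ.0∸n≡0 m))
    ∸-balance zero    (suc n) = ≡.refl
    ∸-balance (suc m) (suc n) =
      ≡.trans (ℕ.+-suc (m ℕ.∸ n) n) (≡.cong suc (∸-balance m n))

  -- The special cases make 0# and 1# evaluate to themselves on the nose.
  ⟦_⟧ᵈ : ℕ × ℕ → Carrier
  ⟦ 0 , 0 ⟧ᵈ = 0#
  ⟦ 1 , 0 ⟧ᵈ = 1#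
  ⟦ i     ⟧ᵈ = difference i

  1≈difference : 1# ≈ difference (1 , 0)
  1≈difference = sym (trans (+-cong (×-homo-1 1#) -0#≈0#) (+-identityʳ 1#))

  ⟦⟧ᵈ≈difference : ∀ i → ⟦ i ⟧ᵈ ≈ difference i
  ⟦⟧ᵈ≈difference (0 , 0)               = sym (-‿inverseʳ 0#)
  ⟦⟧ᵈ≈difference (0 , ℕ.suc n)         = refl
  ⟦⟧ᵈ≈difference (1 , 0)               = 1≈difference
  ⟦⟧ᵈ≈difference (1 , ℕ.suc n)         = refl
  ⟦⟧ᵈ≈difference (suc (suc m) , n) = refl

  ×1-homo-*+* : ∀ k l m n → (k ℕ.* l ℕ.+ m ℕ.* n) · 1#
              ≈ (k · 1#) * (l · 1#) + (m · 1#) * (n · 1#)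
  ×1-homo-*+* k l m n = trans (×-homo-+ 1# (k ℕ.* l) (m ℕ.* n))
                              (+-cong (×1-homo-* k l) (×1-homo-* m n))

  difference-homo-+ : ∀ m n m′ n′ →
    difference (m ℕ.+ m′ , n ℕ.+ n′) ≈ difference (m , n) + difference (m′ , n′)
  difference-homo-+ m n m′ n′ = trans
    (+-cong (×-homo-+ 1# m m′) (-‿cong (×-homo-+ 1# n n′)))
    (+-interchange-- _ _ _ _)

  difference-homo-* : ∀ m n m′ n′ →
    difference (m ℕ.* m′ ℕ.+ n ℕ.* n′ , m ℕ.* n′ ℕ.+ n ℕ.* m′)
      ≈ difference (m , n) * difference (m′ , n′)
  difference-homo-* m n m′ n′ = begin
    difference (m ℕ.* m′ ℕ.+ n ℕ.* n′ , m ℕ.* n′ ℕ.+ n ℕ.* m′)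
      ≈⟨ +-cong (×1-homo-*+* m m′ n n′) (-‿cong (×1-homo-*+* m n′ n m′)) ⟩
    (A * A′ + B * B′) - (A * B′ + B * A′)
      ≈⟨ +-interchange-- _ _ _ _ ⟩
    (A * A′ - A * B′) + (B * B′ - B * A′)
      ≈⟨ +-congˡ (⁻¹-anti-homo‿- _ _) ⟨
    (A * A′ - A * B′) - (B * A′ - B * B′)
      ≈⟨ +-cong (x[y-z]≈xy-xz A A′ B′) (-‿cong (x[y-z]≈xy-xz B A′ B′)) ⟨
    A * (A′ - B′) - B * (A′ - B′)
      ≈⟨ [y-z]x≈yx-zx (A′ - B′) A B ⟨
    (A - B) * (A′ - B′) ∎
    where
    A  = m · 1#
    B  = n · 1#
    A′ = m′ · 1#
    B′ = n′ · 1#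

  differences⟶R : differences -Raw-AlmostCommutative⟶ fromCommutativeRing R
  differences⟶R = record
    { ⟦_⟧    = ⟦_⟧ᵈ
    ; +-homo = λ { i@(m , n) j@(m′ , n′) →
        trans (⟦reduce⟧≈difference (m ℕ.+ m′ , n ℕ.+ n′))
        (trans (difference-homo-+ m n m′ n′)
        (sym (+-cong (⟦⟧ᵈ≈difference i) (⟦⟧ᵈ≈difference j)))) }
    ; *-homo = λ { i@(m , n) j@(m′ , n′) →
        trans (⟦reduce⟧≈difference
                (m ℕ.* m′ ℕ.+ n ℕ.* n′ , m ℕ.* n′ ℕ.+ n ℕ.* m′))
        (trans (difference-homo-* m n m′ n′)
        (sym (*-cong (⟦⟧ᵈ≈difference i) (⟦⟧ᵈ≈difference j)))) }
    ; -‿homo = λ { i@(m , n) →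
        trans (⟦⟧ᵈ≈difference (n , m))
        (trans (sym (⁻¹-anti-homo‿- _ _))
        (sym (-‿cong (⟦⟧ᵈ≈difference i)))) }
    ; 0-homo = refl
    ; 1-homo = refl
    }
    where
    ⟦reduce⟧≈difference : ∀ i → ⟦ reduce i ⟧ᵈ ≈ difference i
    ⟦reduce⟧≈difference i =
      trans (⟦⟧ᵈ≈difference (reduce i)) (difference-reduce i)

  -- Unequal cross sums yield only `nothing`: in a ring of positive characteristic the images may
  -- still agree.
  _≟ᵈ_ : WeaklyDecidable (Induced-equivalence differences⟶R)
  (k , l) ≟ᵈ (m , n) with k ℕ.+ n ℕ.≟ m ℕ.+ l
  ... | no  _  = nothing
  ... | yes eq = just
    (trans (⟦⟧ᵈ≈difference (k , l))
    (trans (difference-cong k l m n eq) (sym (⟦⟧ᵈ≈difference (m , n)))))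

  open import Algebra.Solver.Ring
    differences (fromCommutativeRing R) differences⟶R _≟ᵈ_ public
    using (Polynomial; solve; _:=_; _:+_; _:*_; _:-_; :-_; con)

  𝟘 : ∀ {n} → Polynomial n
  𝟘 = con (0 , 0)

  𝟙 : ∀ {n} → Polynomial n
  𝟙 = con (1 , 0)

-- Cancellation, finite sums, uniqueness of unitriangular expansions

module FieldLemmas {c ℓ₁ ℓ₂ : Level} (K : HeytingField c ℓ₁ ℓ₂) where
  open FieldNotation K
  open HeytingCommutativeRing heytingCommutativeRing using (commutativeRing)
  open DifferenceSolver commutativeRing using (solve; _:=_; _:*_)
  open import Algebra.Properties.Monoid.Sum (CommutativeRing.+-monoid commutativeRing)
    using (sum-init-last; sum-cong-≗)
  open import Algebra.Properties.Monoid.Sum (CommutativeRing.*-monoid commutativeRing)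
    using ()
    renaming (sum-init-last to product-init-last; sum-cong-≗ to product-cong-≗)
  open import Relation.Binary.Reasoning.Setoid setoid
  open import Algebra.Properties.Ring ring using (+-cancelʳ)

  inv-inverseʳ : ∀ {y} (y#0 : y # 0#) → y * inv y#0 ≈ 1#
  inv-inverseʳ y#0 =
    trans (*-congʳ (sym (x-0≈x _))) (proj₂ (proj₂ (#⇒invertible y#0)))

  ÷-*-cancel : ∀ {x y} (y#0 : y # 0#) → x ÷ y [ y#0 ] * y ≈ x
  ÷-*-cancel {x} {y} y#0 = begin
    x * inv y#0 * y    ≈⟨ solve 3 (λ x i y → x :* i :* y := x :* (y :* i)) refl x (inv y#0) y ⟩
    x * (y * inv y#0)  ≈⟨ *-congˡ (inv-inverseʳ y#0) ⟩
    x * 1#             ≈⟨ *-identityʳ x ⟩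
    x                  ∎

  *-cancelʳ-# : ∀ {x y z} → z # 0# → x * z ≈ y * z → x ≈ y
  *-cancelʳ-# {x} {y} {z} z#0 xz≈yz = begin
    x                  ≈⟨ lemma x ⟨
    x * z * inv z#0    ≈⟨ *-congʳ xz≈yz ⟩
    y * z * inv z#0    ≈⟨ lemma y ⟩
    y                  ∎
    where
    lemma : ∀ w → w * z * inv z#0 ≈ w
    lemma w = trans (*-assoc w z _)
                    (trans (*-congˡ (inv-inverseʳ z#0)) (*-identityʳ w))

  sum-snoc : ∀ n (f : ℕ → Carrier) →
             sum {suc n} (λ i → f (toℕ i)) ≈ sum {n} (λ i → f (toℕ i)) + f n
  sum-snoc n f = trans (sum-init-last (λ i → f (toℕ i))) (reflexive (≡.cong₂ _+_
    (sum-cong-≗ {n} (λ i → ≡.cong f (toℕ-inject₁ i))) (≡.cong f (toℕ-fromℕ n))))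

  product-snoc : ∀ n (f : ℕ → Carrier) →
    product {suc n} (λ i → f (toℕ i)) ≈ product {n} (λ i → f (toℕ i)) * f n
  product-snoc n f = trans (product-init-last (λ i → f (toℕ i))) (reflexive (≡.cong₂ _*_
    (product-cong-≗ {n} (λ i → ≡.cong f (toℕ-inject₁ i))) (≡.cong f (toℕ-fromℕ n))))

  sum-zero : ∀ n (f : ℕ → Carrier) → (∀ i → i ℕ.< n → f i ≈ 0#) →
             sum {n} (λ i → f (toℕ i)) ≈ 0#
  sum-zero zero    f f≈0 = refl
  sum-zero (suc n) f f≈0 = begin
    f 0 + sum {n} (λ i → f (suc (toℕ i)))
      ≈⟨ +-cong (f≈0 0 (s≤s z≤n))
           (sum-zero n (λ i → f (suc i)) (λ i i<n → f≈0 (suc i) (s≤s i<n))) ⟩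
    0# + 0#
      ≈⟨ +-identityˡ 0# ⟩
    0# ∎

  sum-split : ∀ m n (f : ℕ → Carrier) →
    sum {m ℕ.+ n} (λ i → f (toℕ i))
      ≈ sum {m} (λ i → f (toℕ i)) + sum {n} (λ i → f (m ℕ.+ toℕ i))
  sum-split zero    n f = sym (+-identityˡ _)
  sum-split (suc m) n f =
    trans (+-congˡ (sum-split m n (λ i → f (suc i)))) (sym (+-assoc _ _ _))

  -- In the equation at m = n every summand with k < n vanishes and the last one is its bare
  -- coefficient, so the top coefficients agree. Cancelling the top summands leaves the same
  -- situation for n - 1.
  unitriangular-unique :
    ∀ (P : ℕ → ℕ → Carrier) → (∀ k → P k k ≈ 1#) → (∀ {k m} → k ℕ.< m → P k m ≈ 0#) →
    ∀ n (σ τ : ℕ → Carrier) →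
    (∀ m → ∑[ k ≤ n ] (σ (toℕ k) * P (toℕ k) m) ≈ ∑[ k ≤ n ] (τ (toℕ k) * P (toℕ k) m)) →
    ∀ {k} → k ≤ n → σ k ≈ τ k
  unitriangular-unique P diag upper n₀ σ τ eq₀ = go n₀ eq₀
    where
    Σ_< : ℕ → (ℕ → Carrier) → ℕ → Carrier
    Σ_< n σ m = sum {n} (λ k → σ (toℕ k) * P (toℕ k) m)
    top : ∀ n (σ : ℕ → Carrier) → Σ_< (suc n) σ n ≈ σ n
    top n σ = begin
      Σ_< (suc n) σ n          ≈⟨ sum-snoc n (λ k → σ k * P k n) ⟩
      Σ_< n σ n + σ n * P n n  ≈⟨ +-cong
                                   (sum-zero n (λ k → σ k * P k n)
                                     (λ k k<n → trans (*-congˡ (upper k<n)) (zeroʳ _)))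
                                   (trans (*-congˡ (diag n)) (*-identityʳ _)) ⟩
      0# + σ n                 ≈⟨ +-identityˡ _ ⟩
      σ n                      ∎
    go : ∀ n → (∀ m → Σ_< (suc n) σ m ≈ Σ_< (suc n) τ m) → ∀ {k} → k ≤ n → σ k ≈ τ k
    go n eq {k} k≤n with k ℕ.≟ n
    ... | yes ≡.refl = trans (sym (top n σ)) (trans (eq n) (top n τ))
    go zero    eq z≤n  | no k≢0 = ⊥-elim (k≢0 ≡.refl)
    go (suc n) eq k≤1+n | no k≢1+n = go n eq′ (ℕ.≤-pred (ℕ.≤∧≢⇒< k≤1+n k≢1+n))
      where
      last≈ : σ (suc n) ≈ τ (suc n)
      last≈ = trans (sym (top (suc n) σ)) (trans (eq (suc n)) (top (suc n) τ))
      eq′ : ∀ m → Σ_< (suc n) σ m ≈ Σ_< (suc n) τ m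
      eq′ m = +-cancelʳ (σ (suc n) * P (suc n) m) _ _ (begin
        Σ_< (suc n) σ m + σ (suc n) * P (suc n) m  ≈⟨ sum-snoc (suc n) (λ k → σ k * P k m) ⟨
        Σ_< (suc (suc n)) σ m                      ≈⟨ eq m ⟩
        Σ_< (suc (suc n)) τ m                      ≈⟨ sum-snoc (suc n) (λ k → τ k * P k m) ⟩
        Σ_< (suc n) τ m + τ (suc n) * P (suc n) m  ≈⟨ +-congˡ (*-congʳ last≈) ⟨
        Σ_< (suc n) τ m + σ (suc n) * P (suc n) m  ∎)

-- q-shifted factorials

module MixedMoments {c ℓ₁ ℓ₂ : Level} (K : HeytingField c ℓ₁ ℓ₂)
  (a b q : HeytingField.Carrier K) (gen : Generic K a b q) where

  open FieldNotation K
  open LittleQJacobi K a b q gen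
  open Generic gen
  open HeytingCommutativeRing heytingCommutativeRing using (commutativeRing)
  open DifferenceSolver commutativeRing
    using (solve; _:=_; _:+_; _:*_; _:-_; :-_; 𝟘; 𝟙)
  open FieldLemmas K
  open import Algebra.Properties.Monoid.Sum (CommutativeRing.+-monoid commutativeRing)
    using (sum-cong-≗)
  open import Relation.Binary.Reasoning.Setoid setoid

  factor : Carrier → ℕ → Carrier
  factor y m = 1# - y * q ^ m

  -- (y q^m; q)_r
  qpoch : Carrier → ℕ → ℕ → Carrier
  qpoch y m zero    = 1#
  qpoch y m (suc r) = factor y m * qpoch y (suc m) r

  -- This is (q;q)_r, written with base 1 and exponent 1 so that the lemmas on `qpoch` apply to it.
  [q]_ : ℕ → Carrier
  [q] r = qpoch 1# 1 r

  qpoch-index : ∀ {y m m′ r r′} → m ≡ m′ → r ≡ r′ → qpoch y m r ≈ qpoch y m′ r′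
  qpoch-index ≡.refl ≡.refl = refl

  factor-index : ∀ {y m m′} → m ≡ m′ → factor y m ≈ factor y m′
  factor-index ≡.refl = refl

  factor-+ : ∀ y m n → factor y (m ℕ.+ n) ≈ 1# - y * (q ^ m * q ^ n)
  factor-+ y m n = +-congˡ (-‿cong (*-congˡ (^-homo-* q m n)))

  qpoch-split : ∀ y m r s → qpoch y m (r ℕ.+ s) ≈ qpoch y m r * qpoch y (m ℕ.+ r) s
  qpoch-split y m zero    s =
    trans (qpoch-index {r = s} (≡.sym (ℕ.+-identityʳ m)) ≡.refl) (sym (*-identityˡ _))
  qpoch-split y m (suc r) s = begin
    factor y m * qpoch y (suc m) (r ℕ.+ s)
      ≈⟨ *-congˡ (qpoch-split y (suc m) r s) ⟩
    factor y m * (qpoch y (suc m) r * qpoch y (suc m ℕ.+ r) s)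
      ≈⟨ *-assoc _ _ _ ⟨
    factor y m * qpoch y (suc m) r * qpoch y (suc m ℕ.+ r) s
      ≈⟨ *-congˡ (qpoch-index {r = s} (≡.sym (ℕ.+-suc m r)) ≡.refl) ⟩
    qpoch y m (suc r) * qpoch y (m ℕ.+ suc r) s ∎

  qpoch-snoc : ∀ y m r → qpoch y m (suc r) ≈ qpoch y m r * factor y (m ℕ.+ r)
  qpoch-snoc y m r = begin
    qpoch y m (suc r)                   ≈⟨ qpoch-index ≡.refl (ℕ.+-comm 1 r) ⟩
    qpoch y m (r ℕ.+ 1)                 ≈⟨ qpoch-split y m r 1 ⟩
    qpoch y m r * (factor y (m ℕ.+ r) * 1#) ≈⟨ *-congˡ (*-identityʳ _) ⟩
    qpoch y m r * factor y (m ℕ.+ r)    ∎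

  qpoch#0 : ∀ {y} → (∀ m → 1# # y * q ^ suc m) → ∀ m r → qpoch y (suc m) r # 0#
  qpoch#0 1#yqᵐ m zero    = 1#0
  qpoch#0 1#yqᵐ m (suc r) = x#0y#0→xy#0 (1#x⇒1-x#0 (1#yqᵐ m)) (qpoch#0 1#yqᵐ (suc m) r)

  factor#0 : ∀ {y} → (∀ m → 1# # y * q ^ suc m) → ∀ m → factor y (suc m) # 0#
  factor#0 1#yqᵐ m = 1#x⇒1-x#0 (1#yqᵐ m)

  1#1qᵐ : ∀ m → 1# # 1# * q ^ suc m
  1#1qᵐ m = #-congˡ (sym (*-identityˡ _)) (1#qᵐ m)

  [q]#0 : ∀ r → [q] r # 0#
  [q]#0 = qpoch#0 1#1qᵐ 0

  -- Product formula for the path sums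

  ab : Carrier
  ab = a * b

  -- Level 0 of `w₁` with a bare natural number as index, which lets the recursion change j without
  -- carrying a bound. On `toℕ j` it agrees with `w₁ 0 i j` by definition.
  eastWeight : ℕ → ℕ → Carrier
  eastWeight i j =
    (q ^ j * factor ab (suc i) * factor a (suc i))
      ÷ (factor ab (suc (i ℕ.+ j)) * factor ab (suc (suc (i ℕ.+ j))))
        [ x#0y#0→xy#0 (1-abqᵐ#0 (i ℕ.+ j)) (1-abqᵐ#0 (suc (i ℕ.+ j))) ]

  -- pathSum k d e j is the sum over the paths from v^0_{k+d,j} to (k,∞) of
  -- nonzero weight, where e = k - j is the number of available south steps.
  pathSum : (k d e j : ℕ) → Carrier
  pathSum k zero    e       j = 1#
  pathSum k (suc d) zero    j = eastWeight (d ℕ.+ k) j * pathSum k d zero j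
  pathSum k (suc d) (suc e) j =
    eastWeight (d ℕ.+ k) j * pathSum k d (suc e) j + pathSum k (suc d) e (suc j)

  -- pathSum k d e j is numerator / denominator, that is
  -- q^(jd) [e+d choose d]_q (aq^(k+1), abq^(k+1); q)_d
  --   / (abq^(k+j+1), abq^(2k+2); q)_d.
  numerator denominator : (k d e j : ℕ) → Carrier
  denominator k d e j =
    [q] e * [q] d * qpoch ab (suc (k ℕ.+ j)) d * qpoch ab (suc (suc (k ℕ.+ k))) d
  numerator k d e j =
    qpoch a (suc k) d * qpoch ab (suc k) d * q ^ (j ℕ.* d) * [q] (e ℕ.+ d)

  -- Here D = q^(d+1), E = q^e and G = abq^(k+j+1). After clearing denominators the claim is
  -- (1-D)(1-GED) + D(1-E)(1-G) = (1-ED)(1-GD), which is the q-Pascal rule when G = 0. Both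
  -- contributions have 1 - GD in their denominators although the sum has not, hence the surplus
  -- `g₂` on both sides.
  pascal-step : ∀ ω W V G E D qe qd P g₁ R xₐ x_c fₐ f_c Q qʲ Z →
    let fd = 1# - 1# * D ; fe = 1# - 1# * E ; g₀ = 1# - G
        r = 1# - G * (E * D) ; fz = 1# - 1# * (E * D) ; g₂ = 1# - G * D in
    ω * (g₁ * g₂) ≈ qʲ * f_c * fₐ →
    W * (qe * qd * P * R) ≈ xₐ * x_c * Q * Z →
    V * (qe * (qd * fd) * (P * g₁ * g₂) * (R * r))
      ≈ (xₐ * fₐ) * (x_c * f_c) * (Q * qʲ * D) * Z * (fe * g₀) →
    (ω * W + V) * (qe * (qd * fd) * (P * g₁) * (R * r)) * g₂
      ≈ (xₐ * fₐ) * (x_c * f_c) * (Q * qʲ) * (Z * fz) * g₂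
  pascal-step ω W V G E D qe qd P g₁ R xₐ x_c fₐ f_c Q qʲ Z hω hW hV = begin
    (ω * W + V) * (qe * (qd * fd) * (P * g₁) * (R * r)) * g₂
      ≈⟨ solve 11 (λ ω W V qe qd fd P g₁ R r g₂ →
           (ω :* W :+ V) :* (qe :* (qd :* fd) :* (P :* g₁) :* (R :* r)) :* g₂
           := (ω :* (g₁ :* g₂)) :* (W :* (qe :* qd :* P :* R)) :* (fd :* r)
              :+ V :* (qe :* (qd :* fd) :* (P :* g₁ :* g₂) :* (R :* r)))
         refl ω W V qe qd fd P g₁ R r g₂ ⟩
    (ω * (g₁ * g₂)) * (W * (qe * qd * P * R)) * (fd * r)
      + V * (qe * (qd * fd) * (P * g₁ * g₂) * (R * r))
      ≈⟨ +-cong (*-congʳ (*-cong hω hW)) hV ⟩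
    (qʲ * f_c * fₐ) * (xₐ * x_c * Q * Z) * (fd * r)
      + (xₐ * fₐ) * (x_c * f_c) * (Q * qʲ * D) * Z * (fe * g₀)
      ≈⟨ solve 11 (λ qʲ f_c fₐ xₐ x_c Q Z fd r D y →
           (qʲ :* f_c :* fₐ) :* (xₐ :* x_c :* Q :* Z) :* (fd :* r)
           :+ (xₐ :* fₐ) :* (x_c :* f_c) :* (Q :* qʲ :* D) :* Z :* y
           := (xₐ :* fₐ) :* (x_c :* f_c) :* (Q :* qʲ) :* Z :* (fd :* r :+ D :* y))
         refl qʲ f_c fₐ xₐ x_c Q Z fd r D (fe * g₀) ⟩
    (xₐ * fₐ) * (x_c * f_c) * (Q * qʲ) * Z * (fd * r + D * (fe * g₀))
      ≈⟨ *-congˡ (solve 3 (λ G E D →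
           (𝟙 :- 𝟙 :* D) :* (𝟙 :- G :* (E :* D)) :+ D :* ((𝟙 :- 𝟙 :* E) :* (𝟙 :- G))
           := (𝟙 :- 𝟙 :* (E :* D)) :* (𝟙 :- G :* D)) refl G E D) ⟩
    (xₐ * fₐ) * (x_c * f_c) * (Q * qʲ) * Z * (fz * g₂)
      ≈⟨ solve 4 (λ x z f g → x :* z :* (f :* g) := x :* (z :* f) :* g) refl _ Z fz g₂ ⟩
    (xₐ * fₐ) * (x_c * f_c) * (Q * qʲ) * (Z * fz) * g₂ ∎
    where
    fd = 1# - 1# * D
    fe = 1# - 1# * E
    g₀ = 1# - G
    r  = 1# - G * (E * D)
    fz = 1# - 1# * (E * D)
    g₂ = 1# - G * D

  eastWeight-* : ∀ i j →
    eastWeight i j * (factor ab (suc (i ℕ.+ j)) * factor ab (suc (suc (i ℕ.+ j))))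
      ≈ q ^ j * factor ab (suc i) * factor a (suc i)
  eastWeight-* i j = ÷-*-cancel _

  -- V is the contribution of the paths starting with a south step.  The
  -- formula for it is multiplied by 1 - q^e so as to hold for e = 0, V = 0# too.
  pathSum-step : ∀ k d e j → e ℕ.+ j ≡ k → ∀ W V →
    W * denominator k d e j ≈ numerator k d e j →
    V * ([q] e * [q] (suc d) * qpoch ab (suc (k ℕ.+ j)) (suc (suc d))
         * qpoch ab (suc (suc (k ℕ.+ k))) (suc d))
      ≈ qpoch a (suc k) (suc d) * qpoch ab (suc k) (suc d) * (q ^ (j ℕ.* suc d) * q ^ suc d)
         * [q] (e ℕ.+ d) * (factor 1# e * factor ab (suc (k ℕ.+ j))) →
    (eastWeight (d ℕ.+ k) j * W + V) * denominator k (suc d) e j ≈ numerator k (suc d) e j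
  pathSum-step k d e j e+j≡k W V hW hV = *-cancelʳ-# g₂#0 (begin
    (ω * W + V) * denominator k (suc d) e j * g₂
      ≈⟨ *-congʳ (*-congˡ (*-cong (*-cong (*-congˡ [q]-suc) P-suc) R-suc)) ⟩
    (ω * W + V) * ([q] e * ([q] d * fd) * (P * g₁) * (R * r)) * g₂
      ≈⟨ pascal-step ω W V G E D ([q] e) ([q] d) P g₁ R xₐ x_c fₐ f_c Q (q ^ j) Z hω hW (begin
           V * ([q] e * ([q] d * fd) * (P * g₁ * g₂) * (R * r))
             ≈⟨ *-congˡ (*-cong (*-cong (*-congˡ [q]-suc) P-suc-suc) R-suc) ⟨
           V * ([q] e * [q] (suc d) * qpoch ab (suc (k ℕ.+ j)) (suc (suc d))
                * qpoch ab (suc (suc (k ℕ.+ k))) (suc d))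
             ≈⟨ hV ⟩
           qpoch a (suc k) (suc d) * qpoch ab (suc k) (suc d) * (q ^ (j ℕ.* suc d) * D)
             * Z * (fe * g₀)
             ≈⟨ *-congʳ (*-congʳ (*-cong xx-suc (*-congʳ Q-suc))) ⟩
           (xₐ * fₐ) * (x_c * f_c) * (Q * q ^ j * D) * Z * (fe * g₀) ∎) ⟩
    (xₐ * fₐ) * (x_c * f_c) * (Q * q ^ j) * (Z * fz) * g₂
      ≈⟨ *-congʳ (*-cong (*-cong xx-suc Q-suc) Z-suc) ⟨
    numerator k (suc d) e j * g₂ ∎)
    where
    ω  = eastWeight (d ℕ.+ k) j
    D  = q ^ suc d
    E  = q ^ e
    G  = ab * q ^ suc (k ℕ.+ j)
    P  = qpoch ab (suc (k ℕ.+ j)) d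
    R  = qpoch ab (suc (suc (k ℕ.+ k))) d
    xₐ = qpoch a (suc k) d
    x_c = qpoch ab (suc k) d
    fₐ = factor a (suc k ℕ.+ d)
    f_c = factor ab (suc k ℕ.+ d)
    Q  = q ^ (j ℕ.* d)
    Z  = [q] (e ℕ.+ d)
    fd = 1# - 1# * D
    fe = 1# - 1# * E
    g₀ = 1# - G
    g₁ = factor ab (suc (k ℕ.+ j) ℕ.+ d)
    r  = 1# - G * (E * D)
    fz = 1# - 1# * (E * D)
    g₂ = 1# - G * D
    [q]-suc : [q] (suc d) ≈ [q] d * fd
    [q]-suc = qpoch-snoc 1# 1 d
    P-suc : qpoch ab (suc (k ℕ.+ j)) (suc d) ≈ P * g₁
    P-suc = qpoch-snoc ab (suc (k ℕ.+ j)) d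
    factor≈ : ∀ n → factor ab (suc (k ℕ.+ j) ℕ.+ n) ≈ 1# - G * q ^ n
    factor≈ n = trans (factor-+ ab (suc (k ℕ.+ j)) n)
                      (+-congˡ (-‿cong (sym (*-assoc _ _ _))))
    P-suc-suc : qpoch ab (suc (k ℕ.+ j)) (suc (suc d)) ≈ P * g₁ * g₂
    P-suc-suc = trans (qpoch-snoc ab (suc (k ℕ.+ j)) (suc d)) (*-cong P-suc (factor≈ (suc d)))
    -- The hypothesis e + j = k enters here: it writes the last factor of (abq^(2k+2);q)_(d+1) as 1
    -- - GED, in the letters of `pascal-step`.
    R-index : suc (suc (k ℕ.+ k)) ℕ.+ d ≡ suc (k ℕ.+ j) ℕ.+ (e ℕ.+ suc d)
    R-index = ≡.trans (≡.cong (λ l → suc (suc (k ℕ.+ l)) ℕ.+ d) (≡.sym e+j≡k)) (lemma k d e j)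
      where
      lemma : ∀ k d e j → suc (suc (k ℕ.+ (e ℕ.+ j))) ℕ.+ d ≡ suc (k ℕ.+ j) ℕ.+ (e ℕ.+ suc d)
      lemma = solve-∀
    R-suc : qpoch ab (suc (suc (k ℕ.+ k))) (suc d) ≈ R * r
    R-suc = trans (qpoch-snoc ab (suc (suc (k ℕ.+ k))) d) (*-congˡ
      (trans (factor-index R-index) (trans (factor≈ (e ℕ.+ suc d))
        (+-congˡ (-‿cong (*-congˡ (^-homo-* q e (suc d))))))))
    xx-suc : qpoch a (suc k) (suc d) * qpoch ab (suc k) (suc d) ≈ (xₐ * fₐ) * (x_c * f_c)
    xx-suc = *-cong (qpoch-snoc a (suc k) d) (qpoch-snoc ab (suc k) d)
    Q-suc : q ^ (j ℕ.* suc d) ≈ Q * q ^ j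
    Q-suc = trans (reflexive (≡.cong (q ^_) (≡.trans (ℕ.*-suc j d) (ℕ.+-comm j (j ℕ.* d)))))
                  (^-homo-* q (j ℕ.* d) j)
    Z-suc : [q] (e ℕ.+ suc d) ≈ Z * fz
    Z-suc = begin
      [q] (e ℕ.+ suc d)            ≈⟨ qpoch-index ≡.refl (ℕ.+-suc e d) ⟩
      [q] (suc (e ℕ.+ d))          ≈⟨ qpoch-snoc 1# 1 (e ℕ.+ d) ⟩
      Z * factor 1# (suc (e ℕ.+ d)) ≈⟨ *-congˡ (factor-index (≡.sym (ℕ.+-suc e d))) ⟩
      Z * factor 1# (e ℕ.+ suc d)  ≈⟨ *-congˡ (factor-+ 1# e (suc d)) ⟩
      Z * fz                       ∎
    g₂#0 : g₂ # 0#
    g₂#0 = #-congʳ (factor≈ (suc d)) (factor#0 1#abqᵐ (k ℕ.+ j ℕ.+ suc d))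
    index₁ : ∀ k d j → suc (k ℕ.+ j) ℕ.+ d ≡ suc (d ℕ.+ k ℕ.+ j)
    index₁ = solve-∀
    index₂ : ∀ k d j → suc (k ℕ.+ j) ℕ.+ suc d ≡ suc (suc (d ℕ.+ k ℕ.+ j))
    index₂ = solve-∀
    hω : ω * (g₁ * g₂) ≈ q ^ j * f_c * fₐ
    hω = begin
      ω * (g₁ * g₂)
        ≈⟨ *-congˡ (*-cong (factor-index (index₁ k d j))
             (trans (sym (factor≈ (suc d))) (factor-index (index₂ k d j)))) ⟩
      ω * (factor ab (suc (d ℕ.+ k ℕ.+ j)) * factor ab (suc (suc (d ℕ.+ k ℕ.+ j))))
        ≈⟨ eastWeight-* (d ℕ.+ k) j ⟩
      q ^ j * factor ab (suc (d ℕ.+ k)) * factor a (suc (d ℕ.+ k))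
        ≈⟨ *-cong (*-congˡ (factor-index (≡.cong suc (ℕ.+-comm d k))))
                  (factor-index (≡.cong suc (ℕ.+-comm d k))) ⟩
      q ^ j * f_c * fₐ ∎

  -- Induction along the recursion: an east step lowers d, a south step lowers e and raises j, so
  -- that e + j = k is preserved.
  pathSum-closed : ∀ k d e j → e ℕ.+ j ≡ k →
    pathSum k d e j * denominator k d e j ≈ numerator k d e j
  pathSum-closed k zero e j _ = begin
    1# * ([q] e * 1# * 1# * 1#)
      ≈⟨ solve 1 (λ x → 𝟙 :* (x :* 𝟙 :* 𝟙 :* 𝟙) := 𝟙 :* 𝟙 :* 𝟙 :* x) refl ([q] e) ⟩
    1# * 1# * 1# * [q] e
      ≈⟨ *-cong (*-congˡ (reflexive (≡.cong (q ^_) (ℕ.*-zeroʳ j))))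
                (qpoch-index ≡.refl (ℕ.+-identityʳ e)) ⟨
    1# * 1# * q ^ (j ℕ.* 0) * [q] (e ℕ.+ 0) ∎
  pathSum-closed k (suc d) zero j j≡k = trans
    (*-congʳ (sym (+-identityʳ _)))
    (pathSum-step k d zero j j≡k (pathSum k d zero j) 0# (pathSum-closed k d zero j j≡k)
      (solve 4 (λ x y z f → 𝟘 :* x := y :* z :* ((𝟙 :- 𝟙 :* 𝟙) :* f)) refl _ _ _ _))
  pathSum-closed k (suc d) (suc e) j e+j≡k =
    pathSum-step k d (suc e) j e+j≡k (pathSum k d (suc e) j) V
      (pathSum-closed k d (suc e) j e+j≡k) (begin
      V * ([q] (suc e) * [q] (suc d) * (g₀ * qpoch ab (suc (suc (k ℕ.+ j))) (suc d)) * R)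
        ≈⟨ *-congˡ (*-congʳ (*-cong (*-congʳ (qpoch-snoc 1# 1 e))
             (*-congˡ (qpoch-index {r = suc d} (≡.cong suc (≡.sym (ℕ.+-suc k j))) ≡.refl)))) ⟩
      V * ([q] e * fe * [q] (suc d) * (g₀ * P) * R)
        ≈⟨ solve 7 (λ V qe fe qd g₀ P R → V :* (qe :* fe :* qd :* (g₀ :* P) :* R)
             := V :* (qe :* qd :* P :* R) :* (fe :* g₀)) refl V ([q] e) fe ([q] (suc d)) g₀ P R ⟩
      V * denominator k (suc d) e (suc j) * (fe * g₀)
        ≈⟨ *-congʳ (pathSum-closed k (suc d) e (suc j) (≡.trans (ℕ.+-suc e j) e+j≡k)) ⟩
      numerator k (suc d) e (suc j) * (fe * g₀)
        ≈⟨ *-congʳ (*-cong (*-congˡ q^) (qpoch-index ≡.refl (ℕ.+-suc e d))) ⟩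
      qpoch a (suc k) (suc d) * qpoch ab (suc k) (suc d) * (q ^ (j ℕ.* suc d) * q ^ suc d)
         * [q] (suc e ℕ.+ d) * (fe * g₀) ∎)
    where
    V  = pathSum k (suc d) e (suc j)
    g₀ = factor ab (suc (k ℕ.+ j))
    fe = factor 1# (suc e)
    P  = qpoch ab (suc (k ℕ.+ suc j)) (suc d)
    R  = qpoch ab (suc (suc (k ℕ.+ k))) (suc d)
    q^ : q ^ (suc j ℕ.* suc d) ≈ q ^ (j ℕ.* suc d) * q ^ suc d
    q^ = trans (^-homo-* q (suc d) (j ℕ.* suc d)) (*-comm _ _)

  mixedMoment : ℕ → ℕ → Carrier
  mixedMoment k d = pathSum k d k 0

  -- At j = 0 the factor (abq^(k+1);q)_d occurs in both `numerator` and `denominator` and can be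
  -- cancelled.
  mixedMoment-closed : ∀ k d →
    mixedMoment k d * ([q] k * [q] d * qpoch ab (suc (suc (k ℕ.+ k))) d)
      ≈ qpoch a (suc k) d * [q] (k ℕ.+ d)
  mixedMoment-closed k d = *-cancelʳ-# (qpoch#0 1#abqᵐ k d) (begin
    h * ([q] k * [q] d * R) * P
      ≈⟨ solve 5 (λ h x y R P → h :* (x :* y :* R) :* P := h :* (x :* y :* P :* R)) refl h _ _ R P ⟩
    h * ([q] k * [q] d * P * R)
      ≈⟨ *-congˡ (*-congʳ (*-congˡ
           (qpoch-index {r = d} (≡.cong suc (≡.sym (ℕ.+-identityʳ k))) ≡.refl))) ⟩
    h * denominator k d k 0
      ≈⟨ pathSum-closed k d k 0 (ℕ.+-identityʳ k) ⟩
    qpoch a (suc k) d * P * 1# * [q] (k ℕ.+ d)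
      ≈⟨ solve 3 (λ x P z → x :* P :* 𝟙 :* z := x :* z :* P) refl _ P _ ⟩
    qpoch a (suc k) d * [q] (k ℕ.+ d) * P ∎)
    where
    h = mixedMoment k d
    P = qpoch ab (suc k) d
    R = qpoch ab (suc (suc (k ℕ.+ k))) d

  -- Coefficients of the little q-Jacobi polynomials

  poch-snoc : ∀ z k → poch z (suc k) ≈ poch z k * (1# - z * q ^ k)
  poch-snoc z k = product-snoc k (λ i → 1# - z * q ^ i)

  poch-cong : ∀ {y z} → y ≈ z → ∀ k → poch y k ≈ poch z k
  poch-cong y≈z zero    = refl
  poch-cong y≈z (suc k) = trans (poch-snoc _ k)
    (trans (*-cong (poch-cong y≈z k) (+-congˡ (-‿cong (*-congʳ y≈z)))) (sym (poch-snoc _ k)))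

  poch≈qpoch : ∀ y m k → poch (y * q ^ m) k ≈ qpoch y m k
  poch≈qpoch y m zero    = refl
  poch≈qpoch y m (suc k) = begin
    poch (y * q ^ m) (suc k)
      ≈⟨ poch-snoc (y * q ^ m) k ⟩
    poch (y * q ^ m) k * (1# - y * q ^ m * q ^ k)
      ≈⟨ *-cong (poch≈qpoch y m k) (+-congˡ (-‿cong (*-assoc y _ _))) ⟩
    qpoch y m k * (1# - y * (q ^ m * q ^ k))
      ≈⟨ *-congˡ (factor-+ y m k) ⟨
    qpoch y m k * factor y (m ℕ.+ k)
      ≈⟨ qpoch-snoc y m k ⟨
    qpoch y m (suc k) ∎

  -- The final factor `q` on the right comes from the argument qx of the series.
  p-ratio : ∀ n m →
    p n (suc m) * (factor 1# (suc m) * factor a (suc m))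
      ≈ p n m * ((1# - q⁻¹ ^ n * q ^ m) * factor ab (suc n ℕ.+ m) * q)
  p-ratio n m = begin
    L * (poch α (suc m) * poch β (suc m) * I′ * (q * q ^ m)) * (fq * fa)
      ≈⟨ *-congʳ (*-congˡ (*-congʳ (*-congʳ (*-cong (poch-snoc α m) (poch-snoc β m))))) ⟩
    L * (A * fα * (B * fβ) * I′ * (q * q ^ m)) * (fq * fa)
      ≈⟨ solve 10 (λ L A fα B fβ I′ q qᵐ fq fa →
           L :* (A :* fα :* (B :* fβ) :* I′ :* (q :* qᵐ)) :* (fq :* fa)
           := L :* (A :* B :* (I′ :* (fq :* fa)) :* qᵐ) :* (fα :* fβ :* q))
         refl L A fα B fβ I′ q (q ^ m) fq fa ⟩
    L * (A * B * (I′ * (fq * fa)) * q ^ m) * (fα * fβ * q)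
      ≈⟨ *-cong (*-congˡ (*-congʳ (*-congˡ inv-ratio))) (*-congʳ (*-congˡ fβ≈)) ⟩
    L * (A * B * I * q ^ m) * (fα * factor ab (suc n ℕ.+ m) * q) ∎
    where
    L  = leadingFactor n
    α  = q⁻¹ ^ n
    β  = a * b * q ^ suc n
    A  = poch α m
    B  = poch β m
    X#0 : ∀ m → poch q m * poch (a * q) m # 0#
    X#0 m = x#0y#0→xy#0 (poch-q#0 m) (poch-aq#0 m)
    I  = inv (X#0 m)
    I′ = inv (X#0 (suc m))
    fα = 1# - α * q ^ m
    fβ = 1# - β * q ^ m
    fq = factor 1# (suc m)
    fa = factor a (suc m)
    fβ≈ : fβ ≈ factor ab (suc n ℕ.+ m)
    fβ≈ = sym (trans (factor-+ ab (suc n) m) (+-congˡ (-‿cong (sym (*-assoc _ _ _)))))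
    inv-ratio : I′ * (fq * fa) ≈ I
    inv-ratio = *-cancelʳ-# (X#0 m) (begin
      I′ * (fq * fa) * (poch q m * poch (a * q) m)
        ≈⟨ solve 5 (λ I′ fq fa x y → I′ :* (fq :* fa) :* (x :* y)
             := (x :* fq) :* (y :* fa) :* I′) refl I′ fq fa _ _ ⟩
      (poch q m * fq) * (poch (a * q) m * fa) * I′
        ≈⟨ *-congʳ (*-cong (*-congˡ (+-congˡ (-‿cong (*-identityˡ _))))
                           (*-congˡ (+-congˡ (-‿cong (sym (*-assoc a q (q ^ m))))))) ⟩
      (poch q m * (1# - q * q ^ m)) * (poch (a * q) m * (1# - a * q * q ^ m)) * I′
        ≈⟨ *-congʳ (*-cong (poch-snoc q m) (poch-snoc (a * q) m)) ⟨
      poch q (suc m) * poch (a * q) (suc m) * I′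
        ≈⟨ inv-inverseʳ (X#0 (suc m)) ⟩
      1#
        ≈⟨ inv-inverseʳ (X#0 m) ⟨
      poch q m * poch (a * q) m * I
        ≈⟨ *-comm _ _ ⟩
      I * (poch q m * poch (a * q) m) ∎)

  q⁻¹^n*q^n≈1 : ∀ n → q⁻¹ ^ n * q ^ n ≈ 1#
  q⁻¹^n*q^n≈1 zero    = *-identityˡ 1#
  q⁻¹^n*q^n≈1 (suc n) = begin
    q⁻¹ * q⁻¹ ^ n * (q * q ^ n)  ≈⟨ solve 4 (λ i x q y → i :* x :* (q :* y)
                                      := (q :* i) :* (x :* y)) refl q⁻¹ _ q _ ⟩
    q * q⁻¹ * (q⁻¹ ^ n * q ^ n)  ≈⟨ *-cong (inv-inverseʳ q#0) (q⁻¹^n*q^n≈1 n) ⟩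
    1# * 1#                      ≈⟨ *-identityˡ 1# ⟩
    1#                           ∎

  -- (-1)^r q^(r choose 2)
  signedPower : ℕ → Carrier
  signedPower zero    = 1#
  signedPower (suc r) = - (q ^ r) * signedPower r

  C₂-suc : ∀ r → suc r C 2 ≡ r ℕ.+ (r C 2)
  C₂-suc r = ≡.trans (≡.sym (nCk+nC[k+1]≡[n+1]C[k+1] r 1)) (≡.cong (ℕ._+ (r C 2)) (nC1≡n r))

  -- Serves to move the sign and the inverse power of q out of the denominator of `leadingFactor`.
  -- The induction matches (r+1 choose 2) = r + (r choose 2) with the new factor -q^r.
  signedPower-inverse : ∀ r → signedPower r * ((- 1#) ^ r * q⁻¹ ^ (r C 2)) ≈ 1#
  signedPower-inverse zero    = trans (*-identityˡ _) (*-identityˡ 1#)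
  signedPower-inverse (suc r) = begin
    - (q ^ r) * S * (- 1# * (- 1#) ^ r * q⁻¹ ^ (suc r C 2))
      ≈⟨ *-congˡ (*-congˡ (trans (reflexive (≡.cong (q⁻¹ ^_) (C₂-suc r)))
                                 (^-homo-* q⁻¹ r (r C 2)))) ⟩
    - (q ^ r) * S * (- 1# * (- 1#) ^ r * (q⁻¹ ^ r * q⁻¹ ^ (r C 2)))
      ≈⟨ solve 5 (λ x S y z w → :- x :* S :* (:- 𝟙 :* y :* (z :* w))
           := (z :* x) :* (S :* (y :* w))) refl (q ^ r) S _ _ _ ⟩
    q⁻¹ ^ r * q ^ r * (S * ((- 1#) ^ r * q⁻¹ ^ (r C 2)))
      ≈⟨ *-cong (q⁻¹^n*q^n≈1 r) (signedPower-inverse r) ⟩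
    1# * 1#
      ≈⟨ *-identityˡ 1# ⟩
    1# ∎
    where S = signedPower r

  poch-aq≈qpoch : ∀ k → poch (a * q) k ≈ qpoch a 1 k
  poch-aq≈qpoch k = trans (sym (poch-cong (*-congˡ (*-identityʳ q)) k)) (poch≈qpoch a 1 k)

  leadingFactor-* : ∀ n →
    leadingFactor n * ((- 1#) ^ n * q⁻¹ ^ (n C 2) * poch (a * b * q ^ suc n) n)
      ≈ poch (a * q) n
  leadingFactor-* n = ÷-*-cancel _

  clear-inverse : ∀ {S z l P y} → S * z ≈ 1# → l * (z * P) ≈ y → l * P ≈ S * y
  clear-inverse {S} {z} {l} {P} {y} Sz≈1 lzP≈y = begin
    l * P              ≈⟨ *-identityˡ _ ⟨
    1# * (l * P)       ≈⟨ *-congʳ Sz≈1 ⟨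
    S * z * (l * P)    ≈⟨ solve 4 (λ S z l P → S :* z :* (l :* P) := S :* (l :* (z :* P)))
                            refl S z l P ⟩
    S * (l * (z * P))  ≈⟨ *-congˡ lzP≈y ⟩
    S * y              ∎

  leadingFactor-closed : ∀ r →
    leadingFactor r * qpoch ab (suc r) r ≈ signedPower r * qpoch a 1 r
  leadingFactor-closed r =
    clear-inverse {z = (- 1#) ^ r * q⁻¹ ^ (r C 2)} (signedPower-inverse r) (begin
      leadingFactor r * ((- 1#) ^ r * q⁻¹ ^ (r C 2) * qpoch ab (suc r) r)
        ≈⟨ *-congˡ (*-congˡ (poch≈qpoch ab (suc r) r)) ⟨
      leadingFactor r * ((- 1#) ^ r * q⁻¹ ^ (r C 2) * poch (a * b * q ^ suc r) r)
        ≈⟨ leadingFactor-* r ⟩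
      poch (a * q) r
        ≈⟨ poch-aq≈qpoch r ⟩
      qpoch a 1 r ∎)

  trivial-product : ∀ {x i} → 1# * 1# * i ≈ 1# → x * (1# * 1# * i * 1#) ≈ x
  trivial-product i≈1 =
    trans (*-congˡ (trans (*-identityʳ _) i≈1)) (*-identityʳ _)

  -- Opaque, because the unfolded p n m is expensive to compare.
  opaque
    coeff : ℕ → ℕ → Carrier
    coeff = p

    coeff≡p : coeff ≡ p
    coeff≡p = ≡.refl

    coeff-ratio : ∀ n m →
      coeff n (suc m) * (factor 1# (suc m) * factor a (suc m))
        ≈ coeff n m * ((1# - q⁻¹ ^ n * q ^ m) * factor ab (suc n ℕ.+ m) * q)
    coeff-ratio = p-ratio

    coeff-0 : ∀ n → coeff n 0 ≈ leadingFactor n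
    coeff-0 n = trivial-product (inv-inverseʳ (x#0y#0→xy#0 1#0 1#0))

  coeff-suc-zero : ∀ n m →
    coeff n m * ((1# - q⁻¹ ^ n * q ^ m) * factor ab (suc n ℕ.+ m) * q) ≈ 0# →
    coeff n (suc m) ≈ 0#
  coeff-suc-zero n m rhs≈0 = *-cancelʳ-#
    {z = factor 1# (suc m) * factor a (suc m)}
    (x#0y#0→xy#0 (factor#0 1#1qᵐ m) (factor#0 1#aqᵐ m))
    (trans (coeff-ratio n m) (trans rhs≈0 (sym (zeroˡ _))))

  vanishing : ∀ {x y z w} → x ≈ 1# → w * ((1# - x) * y * z) ≈ 0#
  vanishing {x} {y} {z} {w} x≈1 = begin
    w * ((1# - x) * y * z)   ≈⟨ *-congˡ (*-congʳ (*-congʳ (+-congˡ (-‿cong x≈1)))) ⟩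
    w * ((1# - 1#) * y * z)  ≈⟨ solve 3 (λ w y z → w :* ((𝟙 :- 𝟙) :* y :* z) := 𝟘) refl w y z ⟩
    0#                       ∎

  -- The ratio contains 1 - q^(-n) q^m, which is zero at m = n; this kills the coefficient of
  -- x^(n+1), and the ratio passes the zero on. With `<′` the case m = n + 1 is the base of the
  -- induction.
  coeff-upper : ∀ {n m} → n ℕ.<′ m → coeff n m ≈ 0#
  coeff-upper {n} (ℕ.<′-base)           = coeff-suc-zero n n (vanishing (q⁻¹^n*q^n≈1 n))
  coeff-upper {n} (ℕ.≤′-step {n = m} n<m) =
    coeff-suc-zero n m (trans (*-congʳ (coeff-upper n<m)) (zeroˡ _))

  -- Here z = q^(m-n) and y = q^r with m + r + 1 = n. Multiplying by qy turns 1 - z into -(1 -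
  -- q^(r+1)): the last factor of (q;q)_(r+1) is thereby absorbed, and the minus sign and q^r
  -- account for the passage from `signedPower (suc r)` to `signedPower r`.
  coeff-step : ∀ c′ c z g y xₘ xᵣ C′ S Z A fq fa →
    z * (q * y) ≈ 1# →
    c′ * (fq * fa) ≈ c * ((1# - z) * g * q) →
    c * (xₘ * (xᵣ * (1# - 1# * (q * y))) * (g * C′)) ≈ - y * S * Z * (fa * A) →
    c′ * (xₘ * fq * xᵣ * C′) * (fa * y) ≈ S * Z * A * (fa * y)
  coeff-step c′ c z g y xₘ xᵣ C′ S Z A fq fa zqy≈1 ratio ih = begin
    c′ * (xₘ * fq * xᵣ * C′) * (fa * y)
      ≈⟨ solve 7 (λ c′ xₘ fq xᵣ C′ fa y → c′ :* (xₘ :* fq :* xᵣ :* C′) :* (fa :* y)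
           := c′ :* (fq :* fa) :* (xₘ :* xᵣ :* C′ :* y)) refl c′ xₘ fq xᵣ C′ fa y ⟩
    c′ * (fq * fa) * (xₘ * xᵣ * C′ * y)
      ≈⟨ *-congʳ ratio ⟩
    c * ((1# - z) * g * q) * (xₘ * xᵣ * C′ * y)
      ≈⟨ solve 8 (λ c z g q xₘ xᵣ C′ y → c :* ((𝟙 :- z) :* g :* q) :* (xₘ :* xᵣ :* C′ :* y)
           := c :* (xₘ :* xᵣ :* (g :* C′)) :* (q :* y :- z :* (q :* y))) refl c z g q xₘ xᵣ C′ y ⟩
    c * (xₘ * xᵣ * (g * C′)) * (q * y - z * (q * y))
      ≈⟨ *-congˡ (+-congˡ (-‿cong zqy≈1)) ⟩
    c * (xₘ * xᵣ * (g * C′)) * (q * y - 1#)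
      ≈⟨ solve 5 (λ c xₘ xᵣ G w → c :* (xₘ :* xᵣ :* G) :* (w :- 𝟙)
           := :- (c :* (xₘ :* (xᵣ :* (𝟙 :- 𝟙 :* w)) :* G))) refl c xₘ xᵣ (g * C′) (q * y) ⟩
    - (c * (xₘ * (xᵣ * (1# - 1# * (q * y))) * (g * C′)))
      ≈⟨ -‿cong ih ⟩
    - (- y * S * Z * (fa * A))
      ≈⟨ solve 5 (λ y S Z fa A → :- (:- y :* S :* Z :* (fa :* A)) := S :* Z :* A :* (fa :* y))
           refl y S Z fa A ⟩
    S * Z * A * (fa * y) ∎

  -- As a quotient, the coefficient of x^m in p_n is (-1)^r q^(r choose 2) [n choose m]_q
  -- (aq^(m+1);q)_r / (abq^(n+m+1);q)_r with r = n - m. The induction on m starts from the constant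
  -- coefficient, the `leadingFactor`.
  coeff-closed : ∀ n m r → m ℕ.+ r ≡ n →
    coeff n m * ([q] m * [q] r * qpoch ab (suc (n ℕ.+ m)) r)
      ≈ signedPower r * [q] n * qpoch a (suc m) r
  coeff-closed n zero .n ≡.refl = begin
    coeff n 0 * (1# * [q] n * qpoch ab (suc (n ℕ.+ 0)) n)
      ≈⟨ *-cong (coeff-0 n) (*-congˡ (qpoch-index {r = n} (≡.cong suc (ℕ.+-identityʳ n)) ≡.refl)) ⟩
    leadingFactor n * (1# * [q] n * qpoch ab (suc n) n)
      ≈⟨ solve 3 (λ l x P → l :* (𝟙 :* x :* P) := l :* P :* x) refl _ _ _ ⟩
    leadingFactor n * qpoch ab (suc n) n * [q] n
      ≈⟨ *-congʳ (leadingFactor-closed n) ⟩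
    signedPower n * qpoch a 1 n * [q] n
      ≈⟨ solve 3 (λ x y z → x :* y :* z := x :* z :* y) refl _ _ _ ⟩
    signedPower n * [q] n * qpoch a 1 n ∎
  coeff-closed n (suc m) r 1+m+r≡n = *-cancelʳ-# (x#0y#0→xy#0 (factor#0 1#aqᵐ m) (^#0 q#0 r)) (begin
    coeff n (suc m) * ([q] (suc m) * [q] r * qpoch ab (suc (n ℕ.+ suc m)) r) * (fa * q ^ r)
      ≈⟨ *-congʳ (*-congˡ (*-cong (*-congʳ (qpoch-snoc 1# 1 m))
           (qpoch-index {r = r} (≡.cong suc (ℕ.+-suc n m)) ≡.refl))) ⟩
    coeff n (suc m) * ([q] m * factor 1# (suc m) * [q] r * C′) * (fa * q ^ r)
      ≈⟨ coeff-step (coeff n (suc m)) (coeff n m) (q⁻¹ ^ n * q ^ m) (factor ab (suc n ℕ.+ m))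
           (q ^ r) ([q] m) ([q] r) C′ (signedPower r) ([q] n) (qpoch a (suc (suc m)) r)
           (factor 1# (suc m)) fa z*q^1+r≈1 (coeff-ratio n m)
           (trans (*-congˡ (*-congʳ (*-congˡ (sym (qpoch-snoc 1# 1 r)))))
                  (coeff-closed n m (suc r) m+1+r≡n)) ⟩
    signedPower r * [q] n * qpoch a (suc (suc m)) r * (fa * q ^ r) ∎)
    where
    fa = factor a (suc m)
    C′ = qpoch ab (suc (suc (n ℕ.+ m))) r
    m+1+r≡n : m ℕ.+ suc r ≡ n
    m+1+r≡n = ≡.trans (ℕ.+-suc m r) 1+m+r≡n
    z*q^1+r≈1 : q⁻¹ ^ n * q ^ m * q ^ suc r ≈ 1#
    z*q^1+r≈1 = begin
      q⁻¹ ^ n * q ^ m * q ^ suc r    ≈⟨ *-assoc _ _ _ ⟩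
      q⁻¹ ^ n * (q ^ m * q ^ suc r)  ≈⟨ *-congˡ (^-homo-* q m (suc r)) ⟨
      q⁻¹ ^ n * q ^ (m ℕ.+ suc r)    ≡⟨ ≡.cong (λ l → q⁻¹ ^ n * q ^ l) m+1+r≡n ⟩
      q⁻¹ ^ n * q ^ n                ≈⟨ q⁻¹^n*q^n≈1 n ⟩
      1#                             ∎

  coeff-diagonal : ∀ n → coeff n n ≈ 1#
  coeff-diagonal n = *-cancelʳ-# ([q]#0 n) (begin
    coeff n n * [q] n              ≈⟨ solve 2 (λ c x → c :* x := c :* (x :* 𝟙 :* 𝟙)) refl _ _ ⟩
    coeff n n * ([q] n * 1# * 1#)  ≈⟨ coeff-closed n n 0 (ℕ.+-identityʳ n) ⟩
    1# * [q] n * 1#                ≈⟨ *-identityʳ _ ⟩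
    1# * [q] n                     ∎)

  -- The terminating hypergeometric sum

  index₁ : ∀ m r → suc (m ℕ.+ m ℕ.+ r) ≡ suc (m ℕ.+ r ℕ.+ m)
  index₁ = solve-∀

  index₂ : ∀ m r → suc (suc (m ℕ.+ m ℕ.+ r) ℕ.+ r) ≡ suc (suc (m ℕ.+ r ℕ.+ (m ℕ.+ r)))
  index₂ = solve-∀

  term-rearrange : ∀ M c xₘ x_d xᵣ x_k P f R S Z aʳ aᵈ →
    M * (x_k * x_d * R) ≈ aᵈ * Z →
    c * (xₘ * xᵣ * P) ≈ S * x_k * aʳ →
    M * c * (xₘ * x_d * xᵣ * (P * (f * R))) * x_k ≈ S * (Z * (aʳ * aᵈ)) * f * x_k
  term-rearrange M c xₘ x_d xᵣ x_k P f R S Z aʳ aᵈ hM hc = begin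
    M * c * (xₘ * x_d * xᵣ * (P * (f * R))) * x_k
      ≈⟨ solve 9 (λ M c xₘ x_d xᵣ x_k P f R → M :* c :* (xₘ :* x_d :* xᵣ :* (P :* (f :* R))) :* x_k
           := M :* (x_k :* x_d :* R) :* (c :* (xₘ :* xᵣ :* P)) :* f) refl M c xₘ x_d xᵣ x_k P f R ⟩
    M * (x_k * x_d * R) * (c * (xₘ * xᵣ * P)) * f
      ≈⟨ *-congʳ (*-cong hM hc) ⟩
    aᵈ * Z * (S * x_k * aʳ) * f
      ≈⟨ solve 6 (λ aᵈ Z S x_k aʳ f → aᵈ :* Z :* (S :* x_k :* aʳ) :* f
           := S :* (Z :* (aʳ :* aᵈ)) :* f :* x_k) refl aᵈ Z S x_k aʳ f ⟩
    S * (Z * (aʳ * aᵈ)) * f * x_k ∎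

  -- Here x = q^r, D = q^(d+1) and G = abq^(2m+r+1). Once the common factors are removed, what is
  -- left is (1-Gx)(1-xD) - (1-x)(1-GxD) = x(1-D)(1-G). The factor (1-D)(1-G), present on both
  -- sides, is cancelled by the caller.
  telescope : ∀ Σ t xₘ xᵣ x_d′ QN Q′ S A x D G →
    let fR = 1# - 1# * x ; fR′ = 1# - 1# * (q * x) ; fd = 1# - 1# * D ; fN = 1# - 1# * (x * D)
        g₀ = 1# - G ; gN = 1# - G * (x * D) ; f₂ = 1# - G * x in
    g₀ * Q′ ≈ QN * gN →
    Σ * (xₘ * xᵣ * (x_d′ * fd) * fN * QN) ≈ - (S * fR * A) →
    t * (xₘ * (x_d′ * fd) * xᵣ * (g₀ * Q′)) ≈ S * A * f₂ →
    (Σ + t) * (xₘ * (xᵣ * fR′) * x_d′ * fN * Q′) * (fd * g₀)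
      ≈ - (- x * S * fR′ * A) * (fd * g₀)
  telescope Σ t xₘ xᵣ x_d′ QN Q′ S A x D G hQ hΣ ht = begin
    (Σ + t) * (xₘ * (xᵣ * fR′) * x_d′ * fN * Q′) * (fd * g₀)
      ≈⟨ solve 10 (λ Σ t xₘ xᵣ fR′ x_d′ fN Q′ fd g₀ →
           (Σ :+ t) :* (xₘ :* (xᵣ :* fR′) :* x_d′ :* fN :* Q′) :* (fd :* g₀)
           := Σ :* (xₘ :* xᵣ :* (x_d′ :* fd) :* fN :* (g₀ :* Q′)) :* fR′
              :+ t :* (xₘ :* (x_d′ :* fd) :* xᵣ :* (g₀ :* Q′)) :* (fR′ :* fN))
           refl Σ t xₘ xᵣ fR′ x_d′ fN Q′ fd g₀ ⟩
    Σ * (xₘ * xᵣ * (x_d′ * fd) * fN * (g₀ * Q′)) * fR′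
      + t * (xₘ * (x_d′ * fd) * xᵣ * (g₀ * Q′)) * (fR′ * fN)
      ≈⟨ +-cong (*-congʳ (trans (*-congˡ (*-congˡ hQ))
           (solve 4 (λ Σ y Q g → Σ :* (y :* (Q :* g)) := Σ :* (y :* Q) :* g) refl Σ _ QN gN)))
           (*-congʳ ht) ⟩
    Σ * (xₘ * xᵣ * (x_d′ * fd) * fN * QN) * gN * fR′ + S * A * f₂ * (fR′ * fN)
      ≈⟨ +-congʳ (*-congʳ (*-congʳ hΣ)) ⟩
    - (S * fR * A) * gN * fR′ + S * A * f₂ * (fR′ * fN)
      ≈⟨ solve 6 (λ S A fR′ x D G →
           :- (S :* (𝟙 :- 𝟙 :* x) :* A) :* (𝟙 :- G :* (x :* D)) :* fR′
           :+ S :* A :* (𝟙 :- G :* x) :* (fR′ :* (𝟙 :- 𝟙 :* (x :* D)))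
           := :- (:- x :* S :* fR′ :* A) :* ((𝟙 :- 𝟙 :* D) :* (𝟙 :- G)))
           refl S A fR′ x D G ⟩
    - (- x * S * fR′ * A) * (fd * g₀) ∎
    where
    fR  = 1# - 1# * x
    fR′ = 1# - 1# * (q * x)
    fd  = 1# - 1# * D
    fN  = 1# - 1# * (x * D)
    g₀  = 1# - G
    gN  = 1# - G * (x * D)
    f₂  = 1# - G * x

  module OrthogonalitySum (m N : ℕ) where

    term : ℕ → Carrier
    term r = mixedMoment (m ℕ.+ r) (N ℕ.∸ r) * coeff (m ℕ.+ r) m

    A : Carrier
    A = [q] (m ℕ.+ N) * qpoch a (suc m) N

    -- With k = m + r, the factor (q;q)_k cancels and the two factorials in a join to
    -- (aq^(m+1);q)_N. Those in ab cover the exponents 2m+r+1 to 2m+2r and 2m+2r+2 to 2m+r+1+N;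
    -- supplying the one missing exponent 2m+2r+1 completes a single factorial of length N + 1 and
    -- leaves that factor on the right.
    term-closed : ∀ r d → r ℕ.+ d ≡ N →
      term r * ([q] m * [q] d * [q] r * qpoch ab (suc (m ℕ.+ m ℕ.+ r)) (suc N))
        ≈ signedPower r * A * factor ab (suc (m ℕ.+ m ℕ.+ r) ℕ.+ r)
    term-closed r d r+d≡N = *-cancelʳ-# ([q]#0 k) (begin
      term r * ([q] m * [q] d * [q] r * qpoch ab (suc (m ℕ.+ m ℕ.+ r)) (suc N)) * [q] k
        ≈⟨ *-congʳ (*-cong (*-congʳ (reflexive (≡.cong (mixedMoment k) N∸r≡d))) (*-congˡ Q-split)) ⟩
      mixedMoment k d * coeff k m * ([q] m * [q] d * [q] r * (P * (f * R))) * [q] k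
        ≈⟨ term-rearrange (mixedMoment k d) (coeff k m) ([q] m) ([q] d) ([q] r) ([q] k) P f R
             (signedPower r) ([q] (k ℕ.+ d)) (qpoch a (suc m) r) (qpoch a (suc k) d)
             (mixedMoment-closed k d) (coeff-closed k m r ≡.refl) ⟩
      signedPower r * ([q] (k ℕ.+ d) * (qpoch a (suc m) r * qpoch a (suc k) d)) * f * [q] k
        ≈⟨ *-congʳ (*-congʳ (*-congˡ (*-cong
             (qpoch-index ≡.refl (≡.trans (ℕ.+-assoc m r d) (≡.cong (m ℕ.+_) r+d≡N)))
             (trans (sym (qpoch-split a (suc m) r d)) (qpoch-index ≡.refl r+d≡N))))) ⟩
      signedPower r * A * f * [q] k ∎)
      where
      k = m ℕ.+ r
      P = qpoch ab (suc (k ℕ.+ m)) r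
      R = qpoch ab (suc (suc (k ℕ.+ k))) d
      f = factor ab (suc (m ℕ.+ m ℕ.+ r) ℕ.+ r)
      N∸r≡d : N ℕ.∸ r ≡ d
      N∸r≡d = ≡.trans (≡.cong (ℕ._∸ r) (≡.sym r+d≡N)) (ℕ.m+n∸m≡n r d)
      Q-split : qpoch ab (suc (m ℕ.+ m ℕ.+ r)) (suc N) ≈ P * (f * R)
      Q-split = begin
        qpoch ab (suc (m ℕ.+ m ℕ.+ r)) (suc N)
          ≈⟨ qpoch-index ≡.refl (≡.trans (≡.cong suc (≡.sym r+d≡N)) (≡.sym (ℕ.+-suc r d))) ⟩
        qpoch ab (suc (m ℕ.+ m ℕ.+ r)) (r ℕ.+ suc d)
          ≈⟨ qpoch-split ab (suc (m ℕ.+ m ℕ.+ r)) r (suc d) ⟩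
        qpoch ab (suc (m ℕ.+ m ℕ.+ r)) r * (f * qpoch ab (suc (suc (m ℕ.+ m ℕ.+ r) ℕ.+ r)) d)
          ≈⟨ *-cong (qpoch-index {r = r} (index₁ m r) ≡.refl)
                    (*-congˡ (qpoch-index {r = d} (index₂ m r) ≡.refl)) ⟩
        P * (f * R) ∎

    partialSum : ℕ → Carrier
    partialSum r = sum {r} (λ i → term (toℕ i))

    -- Up to the factor A / ((q;q)_m (q;q)_N), the summand is
    --   (-1)^r q^(r choose 2) [N choose r]_q (1 - Cq^2r) / (Cq^r; q)_(N+1)
    -- with C = abq^(2m+1), and its first r terms add up to
    --   -(-1)^r q^(r choose 2) [N choose r]_q (1 - q^r) / ((1 - q^N) (Cq^r; q)_N).
    partialSum-closed : ∀ r d → r ℕ.+ d ≡ N →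
      partialSum r * ([q] m * [q] r * [q] d * factor 1# N * qpoch ab (suc (m ℕ.+ m ℕ.+ r)) N)
        ≈ - (signedPower r * factor 1# r * A)
    partialSum-closed zero d _ =
      solve 3 (λ x y z → 𝟘 :* x := :- (y :* (𝟙 :- 𝟙 :* 𝟙) :* z)) refl _ _ _
    partialSum-closed (suc r) d 1+r+d≡N = *-cancelʳ-# fdg₀#0 (begin
      partialSum (suc r) * ([q] m * [q] (suc r) * [q] d * factor 1# N * Q′) * (fd * g₀)
        ≈⟨ *-congʳ (*-cong (sum-snoc r term)
             (*-congʳ (*-cong (*-congʳ (*-congˡ (qpoch-snoc 1# 1 r))) fN≈))) ⟩
      (partialSum r + term r) * ([q] m * ([q] r * factor 1# (suc r)) * [q] d * fN * Q′) * (fd * g₀)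
        ≈⟨ telescope (partialSum r) (term r) ([q] m) ([q] r) ([q] d) QN Q′
             (signedPower r) A (q ^ r) (q ^ suc d) G
             (trans (*-congˡ (qpoch-index {r = N} Q-index ≡.refl))
               (trans (qpoch-snoc ab (suc (m ℕ.+ m ℕ.+ r)) N) (*-congˡ gN≈)))
             (trans (*-congˡ (*-congʳ (*-cong (*-congˡ (sym (qpoch-snoc 1# 1 d))) (sym fN≈))))
               (partialSum-closed r (suc d) r+1+d≡N))
             (trans (*-congˡ (*-cong (*-congʳ (*-congˡ (sym (qpoch-snoc 1# 1 d))))
                                     (*-congˡ (qpoch-index {r = N} Q-index ≡.refl))))
               (trans (term-closed r (suc d) r+1+d≡N) (*-congˡ (factor≈ r)))) ⟩
      - (- (q ^ r) * signedPower r * factor 1# (suc r) * A) * (fd * g₀) ∎)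
      where
      G  = ab * q ^ suc (m ℕ.+ m ℕ.+ r)
      QN = qpoch ab (suc (m ℕ.+ m ℕ.+ r)) N
      Q′ = qpoch ab (suc (m ℕ.+ m ℕ.+ suc r)) N
      fd = 1# - 1# * q ^ suc d
      g₀ = 1# - G
      fN = 1# - 1# * (q ^ r * q ^ suc d)
      fdg₀#0 : fd * g₀ # 0#
      fdg₀#0 = x#0y#0→xy#0 (factor#0 1#1qᵐ d) (factor#0 1#abqᵐ (m ℕ.+ m ℕ.+ r))
      r+1+d≡N : r ℕ.+ suc d ≡ N
      r+1+d≡N = ≡.trans (ℕ.+-suc r d) 1+r+d≡N
      Q-index : suc (m ℕ.+ m ℕ.+ suc r) ≡ suc (suc (m ℕ.+ m ℕ.+ r))
      Q-index = ≡.cong suc (ℕ.+-suc (m ℕ.+ m) r)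
      q^N : q ^ N ≈ q ^ r * q ^ suc d
      q^N = trans (reflexive (≡.cong (q ^_) (≡.sym r+1+d≡N))) (^-homo-* q r (suc d))
      fN≈ : factor 1# N ≈ fN
      fN≈ = +-congˡ (-‿cong (*-congˡ q^N))
      factor≈ : ∀ n → factor ab (suc (m ℕ.+ m ℕ.+ r) ℕ.+ n) ≈ 1# - G * q ^ n
      factor≈ n = trans (factor-+ ab (suc (m ℕ.+ m ℕ.+ r)) n)
                        (+-congˡ (-‿cong (sym (*-assoc _ _ _))))
      gN≈ : factor ab (suc (m ℕ.+ m ℕ.+ r) ℕ.+ N) ≈ 1# - G * (q ^ r * q ^ suc d)
      gN≈ = trans (factor≈ N) (+-congˡ (-‿cong (*-congˡ q^N)))

  orthogonality-0 : ∀ m → OrthogonalitySum.partialSum m 0 1 ≈ 1#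
  orthogonality-0 m = begin
    1# * coeff (m ℕ.+ 0) m + 0#  ≈⟨ +-identityʳ _ ⟩
    1# * coeff (m ℕ.+ 0) m       ≈⟨ *-identityˡ _ ⟩
    coeff (m ℕ.+ 0) m            ≡⟨ ≡.cong (λ n → coeff n m) (ℕ.+-identityʳ m) ⟩
    coeff m m                    ≈⟨ coeff-diagonal m ⟩
    1#                           ∎

  -- `partialSum-closed` needs r + d to equal the upper index, so it covers all terms but the last,
  -- and the last is the negative of their sum. Cancelling 1 - q^(N+1) is what excludes the upper
  -- index 0, which `orthogonality-0` settles.
  orthogonality-suc : ∀ m N → OrthogonalitySum.partialSum m (suc N) (suc (suc N)) ≈ 0#
  orthogonality-suc m N-1 = *-cancelʳ-# D#0 (begin
    partialSum (suc N) * (D * fN)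
      ≈⟨ *-congʳ (sum-snoc N term) ⟩
    (partialSum N + term N) * (D * fN)
      ≈⟨ solve 6 (λ Σ t x y Q f → (Σ :+ t) :* (x :* y :* Q :* f)
           := Σ :* (x :* y :* 𝟙 :* f :* Q) :+ t :* (x :* y :* Q) :* f) refl _ _ _ _ _ _ ⟩
    partialSum N * ([q] m * [q] N * 1# * fN * Q) + term N * D * fN
      ≈⟨ +-cong (partialSum-closed N 0 (ℕ.+-identityʳ N)) (*-congʳ last-term) ⟩
    - (signedPower N * fN * A) + signedPower N * A * fN
      ≈⟨ solve 3 (λ S f A → :- (S :* f :* A) :+ S :* A :* f := 𝟘) refl _ _ _ ⟩
    0#
      ≈⟨ zeroˡ _ ⟨
    0# * (D * fN) ∎)
    where
    N = suc N-1
    open OrthogonalitySum m N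
    fN = factor 1# N
    Q  = qpoch ab (suc (m ℕ.+ m ℕ.+ N)) N
    D  = [q] m * [q] N * Q
    D#0 : D * fN # 0#
    D#0 = x#0y#0→xy#0 (x#0y#0→xy#0 (x#0y#0→xy#0 ([q]#0 m) ([q]#0 N))
            (qpoch#0 1#abqᵐ (m ℕ.+ m ℕ.+ N) N)) (factor#0 1#1qᵐ N-1)
    last-term : term N * D ≈ signedPower N * A
    last-term = begin
      mixedMoment (m ℕ.+ N) (N ℕ.∸ N) * coeff (m ℕ.+ N) m * D
        ≈⟨ *-congʳ (*-congʳ (reflexive (≡.cong (mixedMoment (m ℕ.+ N)) (ℕ.n∸n≡0 N)))) ⟩
      1# * coeff (m ℕ.+ N) m * D
        ≈⟨ *-cong (*-identityˡ _) (*-congˡ (qpoch-index {r = N} (index₁ m N) ≡.refl)) ⟩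
      coeff (m ℕ.+ N) m * ([q] m * [q] N * qpoch ab (suc (m ℕ.+ N ℕ.+ m)) N)
        ≈⟨ coeff-closed (m ℕ.+ N) m N ≡.refl ⟩
      signedPower N * [q] (m ℕ.+ N) * qpoch a (suc m) N
        ≈⟨ *-assoc _ _ _ ⟩
      signedPower N * A ∎

  -- Expansion of powers of x and uniqueness of the mixed moments

  x^-diagonal : ∀ n → x^ n n ≈ 1#
  x^-diagonal n with n ℕ.≟ n
  ... | yes _   = refl
  ... | no  n≢n = ⊥-elim (n≢n ≡.refl)

  x^-off-diagonal : ∀ {n m} → n ≢ m → x^ n m ≈ 0#
  x^-off-diagonal {n} {m} n≢m with n ℕ.≟ m
  ... | yes n≡m = ⊥-elim (n≢m n≡m)
  ... | no  _   = refl

  σ : ℕ → ℕ → Carrier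
  σ n k = mixedMoment k (n ℕ.∸ k)

  -- If m > n, every p_k with k ≤ n has degree below m. Otherwise n = m + N: the summands with k < m
  -- vanish by degree, and k = m + r identifies the others with the sum of `OrthogonalitySum`.
  coeff-expansion : ∀ n m → x^ n m ≈ ∑[ k ≤ n ] (σ n (toℕ k) * coeff (toℕ k) m)
  coeff-expansion n m with m ℕ.≤? n
  ... | no m≰n = trans (x^-off-diagonal {n} {m} λ { ≡.refl → m≰n ℕ.≤-refl })
      (sym (sum-zero (suc n) (λ k → σ n k * coeff k m)
        λ k k≤n → trans (*-congˡ (coeff-upper (ℕ.≤⇒≤′ (ℕ.≤-trans k≤n (ℕ.≰⇒> m≰n)))))
                        (zeroʳ _)))
  ... | yes m≤n = ≡.subst
      (λ n → x^ n m ≈ ∑[ k ≤ n ] (σ n (toℕ k) * coeff (toℕ k) m))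
      (ℕ.m+[n∸m]≡n m≤n) (lemma (n ℕ.∸ m))
    where
    summand : ℕ → ℕ → Carrier
    summand N k = σ (m ℕ.+ N) k * coeff k m
    low : ∀ N → sum {m} (λ i → summand N (toℕ i)) ≈ 0#
    low N = sum-zero m (summand N)
      λ k k<m → trans (*-congˡ (coeff-upper (ℕ.≤⇒≤′ k<m))) (zeroʳ _)
    high : ∀ N → sum {suc N} (λ i → summand N (m ℕ.+ toℕ i)) ≈ OrthogonalitySum.partialSum m N (suc N)
    high N = reflexive (sum-cong-≗ {suc N} λ i → ≡.cong
      (λ d → mixedMoment (m ℕ.+ toℕ i) d * coeff (m ℕ.+ toℕ i) m) (ℕ.[m+n]∸[m+o]≡n∸o m N (toℕ i)))
    value : ∀ N → OrthogonalitySum.partialSum m N (suc N) ≈ x^ (m ℕ.+ N) m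
    value zero = trans (orthogonality-0 m)
      (sym (≡.subst (λ n → x^ n m ≈ 1#) (≡.sym (ℕ.+-identityʳ m)) (x^-diagonal m)))
    value (suc N) = trans (orthogonality-suc m N)
      (sym (x^-off-diagonal (λ e → ℕ.m+1+n≢m m e)))
    lemma : ∀ N → x^ (m ℕ.+ N) m ≈ ∑[ k ≤ m ℕ.+ N ] summand N (toℕ k)
    lemma N = sym (begin
      sum {suc (m ℕ.+ N)} (λ i → summand N (toℕ i))
        ≡⟨ ≡.cong (λ l → sum {l} (λ i → summand N (toℕ i))) (≡.sym (ℕ.+-suc m N)) ⟩
      sum {m ℕ.+ suc N} (λ i → summand N (toℕ i))
        ≈⟨ sum-split m (suc N) (summand N) ⟩
      sum {m} (λ i → summand N (toℕ i)) + sum {suc N} (λ i → summand N (m ℕ.+ toℕ i))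
        ≈⟨ +-cong (low N) (trans (high N) (value N)) ⟩
      0# + x^ (m ℕ.+ N) m
        ≈⟨ +-identityˡ _ ⟩
      x^ (m ℕ.+ N) m ∎)

  σ-isMixedMoments : IsMixedMoments σ
  σ-isMixedMoments = ≡.subst
    (λ P → ∀ n m → x^ n m ≈ ∑[ k ≤ n ] (σ n (toℕ k) * P (toℕ k) m)) coeff≡p coeff-expansion

  mixedMoments-unique : ∀ τ → IsMixedMoments τ → ∀ {n k} → k ≤ n → τ n k ≈ σ n k
  mixedMoments-unique τ isτ {n} = unitriangular-unique coeff coeff-diagonal
    (λ k<m → coeff-upper (ℕ.≤⇒≤′ k<m)) n (τ n) (σ n)
    (λ m → trans (sym (isτ′ n m)) (coeff-expansion n m))
    where
    isτ′ : ∀ n m → x^ n m ≈ ∑[ k ≤ n ] (τ n (toℕ k) * coeff (toℕ k) m)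
    isτ′ = ≡.subst
      (λ P → ∀ n m → x^ n m ≈ ∑[ k ≤ n ] (τ n (toℕ k) * P (toℕ k) m)) (≡.sym coeff≡p) isτ

-- Vertices, vertical rays and columns along a path

Vertex-≡ : ∀ {u u′} → level u ≡ level u′ → column u ≡ column u′ →
           toℕ (index u) ≡ toℕ (index u′) → u ≡ u′
Vertex-≡ {v t i j} {v .t .i j′} ≡.refl ≡.refl eq = ≡.cong (v t i) (toℕ-injective eq)

right-injective : ∀ {u u′} → right u ≡ right u′ → u ≡ u′
right-injective {v t i j} {v t′ i′ j′} eq = Vertex-≡
  (≡.cong level eq) (ℕ.suc-injective (≡.cong column eq))
  (≡.trans (≡.sym (toℕ-inject₁ j))
    (≡.trans (≡.cong (λ u → toℕ (index u)) eq) (toℕ-inject₁ j′)))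

column-above : ∀ u → column (above u) ≡ column u
column-above (v t i j) with suc (toℕ j) ℕ.<? suc i
... | yes _ = ≡.refl
... | no  _ = ≡.refl

above-cases : ∀ u →
  (level (above u) ≡ level u × toℕ (index (above u)) ≡ suc (toℕ (index u)))
  ⊎ (toℕ (index u) ≡ column u × level (above u) ≡ suc (level u) × toℕ (index (above u)) ≡ 0)
above-cases (v t i j) with suc (toℕ j) ℕ.<? suc i
... | yes j<i = inj₁ (≡.refl , toℕ-fromℕ< j<i)
... | no  j≮i = inj₂ (ℕ.≤-antisym (ℕ.≤-pred (toℕ<n j)) (ℕ.≤-pred (ℕ.≮⇒≥ j≮i)) , ≡.refl , ≡.refl)

-- The number of vertical edges below u in its column, that is, (i+1) times the height in column i.
position : Vertex → ℕ
position u = level u ℕ.* suc (column u) ℕ.+ toℕ (index u)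

position-above : ∀ u → position (above u) ≡ suc (position u)
position-above u with above u | column-above u | above-cases u
... | v _ _ _ | ≡.refl | inj₁ (≡.refl , j≡)        =
  ≡.trans (≡.cong (level u ℕ.* suc (column u) ℕ.+_) j≡) (ℕ.+-suc _ _)
... | v _ _ _ | ≡.refl | inj₂ (j≡i , ≡.refl , j≡0) =
  ≡.trans (≡.cong (suc (level u) ℕ.* suc (column u) ℕ.+_) j≡0)
  (≡.trans (ℕ.+-identityʳ _)
  (≡.cong suc (≡.trans (ℕ.+-comm (column u) _)
    (≡.cong (level u ℕ.* suc (column u) ℕ.+_) (≡.sym j≡i)))))

-- B(i+1) ≤ t(i+1) + j < (t+1)(i+1) forces B ≤ t, and the level t is at most the height.
position⇒height : ∀ B u → B ℕ.* suc (column u) ≤ position u → (+ B / 1) ℚᵘ.≤ height u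
position⇒height B u@(v t i j) B≤ = ℚᵘ.≤-trans
  (*≤* (ℤ.*-monoʳ-≤-nonNeg (+ 1) (+≤+ B≤t)))
  (ℚᵘ.p≤p+q (+ t / 1) (+ toℕ j / suc i))
  where
  B≤t : B ≤ t
  B≤t = ℕ.≤-pred (ℕ.*-cancelʳ-< (suc i) B (suc t) (ℕ.≤-<-trans B≤
    (ℕ.<-≤-trans (ℕ.+-monoʳ-< (t ℕ.* suc i) (toℕ<n j))
                 (ℕ.≤-reflexive (ℕ.+-comm (t ℕ.* suc i) (suc i))))))

climb : Vertex → ℕ → Vertex
climb u zero    = u
climb u (suc m) = above (climb u m)

column-climb : ∀ u m → column (climb u m) ≡ column u
column-climb u zero    = ≡.refl
column-climb u (suc m) = ≡.trans (column-above (climb u m)) (column-climb u m)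

position-climb : ∀ u m → position (climb u m) ≡ m ℕ.+ position u
position-climb u zero    = ≡.refl
position-climb u (suc m) =
  ≡.trans (position-above (climb u m)) (≡.cong suc (position-climb u m))

vertical : ∀ u → SE (column u) u
vertical u = record
  { vertex   = climb u
  ; vertex-0 = ≡.refl
  ; step     = λ m → south ≡.refl
  -- The bound 0 makes the weight of the ray the empty product.
  ; column→k = 0 , λ m _ → column-climb u m
  ; height→∞ = λ B → B ℕ.* suc (column u) , λ m B≤m → position⇒height B (climb u m)
      (ℕ.≤-trans (ℕ.≤-reflexive (≡.cong (λ i → B ℕ.* suc i) (column-climb u m)))
      (ℕ.≤-trans B≤m (ℕ.≤-trans (ℕ.m≤m+n m (position u))
      (ℕ.≤-reflexive (≡.sym (position-climb u m))))))
  }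

extend : ∀ {k u u′} → Step u u′ → SE k u → SE k u′
extend {u = u} {u′} s p = record
  { vertex   = vertex
  ; vertex-0 = ≡.refl
  ; step     = step
  -- The bound `suc M` also fixes the range of the weight product: it gains exactly the new step, as
  -- `weight-extend` requires.
  ; column→k = let M , col≡k = P.column→k in suc M , λ { (suc m) (s≤s M≤m) → col≡k m M≤m }
  ; height→∞ = λ B → let M , B≤ = P.height→∞ B in suc M , λ { (suc m) (s≤s M≤m) → B≤ m M≤m }
  }
  where
  module P = SE p
  vertex : ℕ → Vertex
  vertex zero    = u′
  vertex (suc m) = P.vertex m
  step : ∀ m → Step (vertex (suc m)) (vertex m)
  step zero    = ≡.subst (λ u → Step u u′) (≡.sym P.vertex-0) s
  step (suc m) = P.step m

column-step : ∀ {u u′} → Step u u′ → column u ≤ column u′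
column-step (east ≡.refl)          = ℕ.n≤1+n _
column-step {u′ = u′} (south ≡.refl) = ℕ.≤-reflexive (column-above u′)

module _ {f : ℕ → Vertex} (st : ∀ m → Step (f (suc m)) (f m)) where

  column-descends : ∀ m n → column (f (m ℕ.+ n)) ≤ column (f n)
  column-descends zero    n = ℕ.≤-refl
  column-descends (suc m) n = ℕ.≤-trans (column-step (st (m ℕ.+ n))) (column-descends m n)

  limit≤column : ∀ {k M} → (∀ m → M ≤ m → column (f m) ≡ k) → ∀ n → k ≤ column (f n)
  limit≤column {M = M} col≡k n = ℕ.≤-trans
    (ℕ.≤-reflexive (≡.sym (col≡k (M ℕ.+ n) (ℕ.m≤m+n M n)))) (column-descends M n)

  -- Columns never increase with m, and an east step lowers them. A path that starts in its limit
  -- column therefore has south steps only, and these determine it.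
  limit-start⇒climb : ∀ {M} → (∀ m → M ≤ m → column (f m) ≡ column (f 0)) →
                      ∀ m → f m ≡ climb (f 0) m
  limit-start⇒climb col≡k zero    = ≡.refl
  limit-start⇒climb col≡k (suc m) with st m
  ... | south eq = ≡.trans eq (≡.cong above (limit-start⇒climb col≡k m))
  ... | east  eq = ⊥-elim (ℕ.<-irrefl ≡.refl (ℕ.≤-trans
    (ℕ.≤-reflexive (≡.sym (≡.cong column eq)))
    (ℕ.≤-trans (≡.subst (λ l → column (f l) ≤ column (f 0)) (ℕ.+-identityʳ m) (column-descends m 0))
               (limit≤column col≡k (suc m)))))

-- Enumeration of the paths that may have nonzero weight

module NonzeroPaths (k : ℕ) where

  -- v^0_{k+d,j}
  V : ∀ d j → .(j ≤ k) → Vertex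
  V d j j≤k = v 0 (d ℕ.+ k) (fromℕ< (s≤s (ℕ.≤-trans j≤k (ℕ.m≤n+m k d))))

  toℕ-index-V : ∀ d j .(j≤k : j ≤ k) → toℕ (index (V d j j≤k)) ≡ j
  toℕ-index-V d j j≤k = toℕ-fromℕ< (s≤s (ℕ.≤-trans j≤k (ℕ.m≤n+m k d)))

  right-V : ∀ d j .(j≤k : j ≤ k) → V (suc d) j j≤k ≡ right (V d j j≤k)
  right-V d j j≤k = Vertex-≡ ≡.refl ≡.refl
    (≡.trans (toℕ-index-V (suc d) j j≤k)
      (≡.sym (≡.trans (toℕ-inject₁ (index (V d j j≤k))) (toℕ-index-V d j j≤k))))

  above-V : ∀ d j (j<k : j ℕ.< k) → V d (suc j) j<k ≡ above (V d j (ℕ.<⇒≤ j<k))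
  above-V d j j<k with above-cases (V d j (ℕ.<⇒≤ j<k))
  ... | inj₁ (level≡ , index≡) = Vertex-≡ (≡.sym level≡) (≡.sym (column-above (V d j (ℕ.<⇒≤ j<k))))
    (≡.trans (toℕ-index-V d (suc j) j<k)
      (≡.sym (≡.trans index≡ (≡.cong suc (toℕ-index-V d j (ℕ.<⇒≤ j<k))))))
  ... | inj₂ (index≡column , _) = ⊥-elim (ℕ.<-irrefl
    (≡.trans (≡.sym (toℕ-index-V d j (ℕ.<⇒≤ j<k))) index≡column)
    (ℕ.<-≤-trans j<k (ℕ.m≤n+m k d)))

  bound : ∀ e {j} → e ℕ.+ j ≡ k → j ≤ k
  bound e {j} e+j≡k = ≡.subst (j ≤_) e+j≡k (ℕ.m≤n+m j e)

  shift : ∀ e {j} → suc e ℕ.+ j ≡ k → e ℕ.+ suc j ≡ k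
  shift e {j} = ≡.trans (ℕ.+-suc e j)

  east-V : ∀ d j .(j≤k : j ≤ k) → Step (V d j j≤k) (V (suc d) j j≤k)
  east-V d j j≤k = east (right-V d j j≤k)

  south-V : ∀ d j (j<k : j ℕ.< k) → Step (V d (suc j) j<k) (V d j (ℕ.<⇒≤ j<k))
  south-V d j j<k = south (above-V d j j<k)

  viaEast : ∀ d e j (e+j≡k : e ℕ.+ j ≡ k) →
            SE k (V d j (bound e e+j≡k)) → SE k (V (suc d) j (bound e e+j≡k))
  viaEast d e j e+j≡k = extend (east-V d j (bound e e+j≡k))

  viaSouth : ∀ d e j (e+j≡k : suc e ℕ.+ j ≡ k) →
    SE k (V d (suc j) (bound e (shift e e+j≡k))) → SE k (V d j (bound (suc e) e+j≡k))
  viaSouth d e j e+j≡k = extend (south-V d j (bound e (shift e e+j≡k)))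

  -- Follows the clauses of `pathSum`. For e = 0 and d > 0 there is no south branch, because
  -- climbing past index k outside column k leads into `Above`.
  paths : ∀ d e j (e+j≡k : e ℕ.+ j ≡ k) → List (SE k (V d j (bound e e+j≡k)))
  paths zero    e       j e+j≡k = vertical (V 0 j (bound e e+j≡k)) ∷ []
  paths (suc d) zero    j e+j≡k = map (viaEast d zero j e+j≡k) (paths d zero j e+j≡k)
  paths (suc d) (suc e) j e+j≡k =
    map (viaEast d (suc e) j e+j≡k) (paths d (suc e) j e+j≡k)
      ++ map (viaSouth (suc d) e j e+j≡k) (paths (suc d) e (suc j) (shift e e+j≡k))

  paths-unique : ∀ d e j (e+j≡k : e ℕ.+ j ≡ k) →
                 Unique (SE-setoid k (V d j (bound e e+j≡k))) (paths d e j e+j≡k)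
  viaEast-unique : ∀ d e j (e+j≡k : e ℕ.+ j ≡ k) →
                   Unique (SE-setoid k (V (suc d) j (bound e e+j≡k)))
                          (map (viaEast d e j e+j≡k) (paths d e j e+j≡k))

  viaEast-unique d e j e+j≡k = Unique.map⁺
    (SE-setoid k (V d j (bound e e+j≡k))) (SE-setoid k (V (suc d) j (bound e e+j≡k)))
    (λ eq → eq ∘ suc) (paths-unique d e j e+j≡k)

  paths-unique zero    e       j e+j≡k = [] ∷ []
  paths-unique (suc d) zero    j e+j≡k = viaEast-unique d zero j e+j≡k
  paths-unique (suc d) (suc e) j e+j≡k = Unique.++⁺ S (viaEast-unique d (suc e) j e+j≡k)
    (Unique.map⁺ S′ S (λ eq → eq ∘ suc) (paths-unique (suc d) e (suc j) (shift e e+j≡k)))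
    (λ {x} → disjoint {x})
    where
    S  = SE-setoid k (V (suc d) j (bound (suc e) e+j≡k))
    S′ = SE-setoid k (V (suc d) (suc j) (bound e (shift e e+j≡k)))
    -- The next vertex is in column k + d after an east step and in column k + d + 1 after a south
    -- step.
    disjoint : Disjoint S (map (viaEast d (suc e) j e+j≡k) (paths d (suc e) j e+j≡k))
      (map (viaSouth (suc d) e j e+j≡k) (paths (suc d) e (suc j) (shift e e+j≡k)))
    disjoint {x} (∈east , ∈south)
      with p  , x≈p  ← Any.satisfied (Any.map⁻ ∈east)
         | p′ , x≈p′ ← Any.satisfied (Any.map⁻ ∈south) = ℕ.1+n≢n (≡.cong column
      (≡.trans (≡.sym (SE.vertex-0 p′)) (≡.trans (≡.sym (x≈p′ 1))
        (≡.trans (x≈p 1) (SE.vertex-0 p)))))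

  -- Stated for a bare vertex sequence, so that an induction can pass to `f ∘ suc` without
  -- rebuilding a path.
  Listed : (ℕ → Vertex) → ∀ d e j → e ℕ.+ j ≡ k → Set
  Listed f d e j e+j≡k = Any (λ p → ∀ m → f m ≡ SE.vertex p m) (paths d e j e+j≡k)

  viaEast-listed : ∀ {f} d e j e+j≡k → f 0 ≡ V (suc d) j (bound e e+j≡k) →
                   Listed (f ∘ suc) d e j e+j≡k → Listed f (suc d) e j e+j≡k
  viaEast-listed d zero    j e+j≡k f0≡ =
    Any.map⁺ ∘ Any.map λ { eq zero → f0≡ ; eq (suc m) → eq m }
  viaEast-listed d (suc e) j e+j≡k f0≡ =
    Any.++⁺ˡ ∘ Any.map⁺ ∘ Any.map λ { eq zero → f0≡ ; eq (suc m) → eq m }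

  viaSouth-listed : ∀ {f} d e j e+j≡k → f 0 ≡ V (suc d) j (bound (suc e) e+j≡k) →
                    Listed (f ∘ suc) (suc d) e (suc j) (shift e e+j≡k) →
                    Listed f (suc d) (suc e) j e+j≡k
  viaSouth-listed d e j e+j≡k f0≡ =
    Any.++⁺ʳ (map (viaEast d (suc e) j e+j≡k) (paths d (suc e) j e+j≡k))
      ∘ Any.map⁺ ∘ Any.map λ { eq zero → f0≡ ; eq (suc m) → eq m }

  -- The vertices beyond column k all of whose incoming paths from (k,∞)
  -- use an east step of height at least 1.
  Above : Vertex → Set
  Above u = k ℕ.< column u × (0 ℕ.< level u ⊎ k ℕ.< toℕ (index u))

  above-Above : ∀ {u} → Above u → Above (above u)
  above-Above {u} (k<i , high) =
    ≡.subst (k ℕ.<_) (≡.sym (column-above u)) k<i , go (above-cases u) high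
    where
    go : _ → 0 ℕ.< level u ⊎ k ℕ.< toℕ (index u) →
         0 ℕ.< level (above u) ⊎ k ℕ.< toℕ (index (above u))
    go (inj₁ (t≡ , _))     (inj₁ 0<t) = inj₁ (≡.subst (0 ℕ.<_) (≡.sym t≡) 0<t)
    go (inj₁ (_ , j≡))     (inj₂ k<j) = inj₂ (≡.subst (k ℕ.<_) (≡.sym j≡) (ℕ.m<n⇒m<1+n k<j))
    go (inj₂ (_ , t≡ , _)) _          = inj₁ (≡.subst (0 ℕ.<_) (≡.sym t≡) (s≤s z≤n))

  above-V-Above : ∀ d (0+k≡k : 0 ℕ.+ k ≡ k) → Above (above (V (suc d) k (bound 0 0+k≡k)))
  above-V-Above d e = ≡.subst (k ℕ.<_) (≡.sym (column-above u)) (s≤s (ℕ.m≤n+m k d)) ,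
    (case above-cases u of λ where
      (inj₁ (_ , j≡))     → inj₂ (ℕ.≤-reflexive (≡.sym
        (≡.trans j≡ (≡.cong suc (toℕ-index-V (suc d) k (bound 0 e))))))
      (inj₂ (_ , t≡ , _)) → inj₁ (≡.subst (0 ℕ.<_) (≡.sym t≡) (s≤s z≤n)))
    where u = V (suc d) k (bound 0 e)

-- Weights of the enumerated paths and vanishing of all others

module PathWeights {c ℓ₁ ℓ₂ : Level} (K : HeytingField c ℓ₁ ℓ₂)
  (a b q : HeytingField.Carrier K) (gen : Generic K a b q) (k : ℕ) where

  open FieldNotation K
  open PathSums K
  open LittleQJacobi K a b q gen
  open MixedMoments K a b q gen using (eastWeight; pathSum; mixedMoment)
  open NonzeroPaths k

  prefixWeight : ∀ {f : ℕ → Vertex} → (∀ m → Step (f (suc m)) (f m)) → ℕ → Carrier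
  prefixWeight st M = ∏[ m < M ] stepWeight w₁ (st (toℕ m))

  stepWeight-subst : ∀ {u ũ u′} (u≡ũ : u ≡ ũ) (s : Step u u′) →
    stepWeight w₁ (≡.subst (λ u → Step u u′) u≡ũ s) ≡ stepWeight w₁ s
  stepWeight-subst ≡.refl s = ≡.refl

  weight-extend : ∀ {u u′} (s : Step u u′) (p : SE k u) →
                  weight w₁ (extend s p) ≈ stepWeight w₁ s * weight w₁ p
  weight-extend s p = *-congʳ (reflexive (stepWeight-subst (≡.sym (SE.vertex-0 p)) s))

  stepWeight-east-V : ∀ d j .(j≤k : j ≤ k) →
                      stepWeight w₁ (east-V d j j≤k) ≡ eastWeight (d ℕ.+ k) j
  stepWeight-east-V d j j≤k = ≡.cong (eastWeight (d ℕ.+ k)) (toℕ-index-V d j j≤k)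

  total : ∀ {u} → List (SE k u) → Carrier
  total = foldr (λ p acc → weight w₁ p + acc) 0#

  total-++ : ∀ {u} (ps ps′ : List (SE k u)) → total (ps ++ ps′) ≈ total ps + total ps′
  total-++ []       ps′ = sym (+-identityˡ _)
  total-++ (p ∷ ps) ps′ = trans (+-congˡ (total-++ ps ps′)) (sym (+-assoc _ _ _))

  total-extend : ∀ {u u′} (s : Step u u′) (ps : List (SE k u)) →
                 total (map (extend s) ps) ≈ stepWeight w₁ s * total ps
  total-extend s []       = sym (zeroʳ _)
  total-extend s (p ∷ ps) =
    trans (+-cong (weight-extend s p) (total-extend s ps)) (sym (distribˡ _ _ _))

  total-paths : ∀ d e j (e+j≡k : e ℕ.+ j ≡ k) → total (paths d e j e+j≡k) ≈ pathSum k d e j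
  total-viaEast : ∀ d e j (e+j≡k : e ℕ.+ j ≡ k) →
    total (map (viaEast d e j e+j≡k) (paths d e j e+j≡k)) ≈ eastWeight (d ℕ.+ k) j * pathSum k d e j

  total-viaEast d e j e+j≡k = trans (total-extend (east-V d j (bound e e+j≡k)) (paths d e j e+j≡k))
    (*-cong (reflexive (stepWeight-east-V d j (bound e e+j≡k))) (total-paths d e j e+j≡k))

  total-paths zero    e       j e+j≡k = +-identityʳ 1#
  total-paths (suc d) zero    j e+j≡k = total-viaEast d zero j e+j≡k
  total-paths (suc d) (suc e) j e+j≡k = trans
    (total-++ (map (viaEast d (suc e) j e+j≡k) (paths d (suc e) j e+j≡k)) _)
    (+-cong (total-viaEast d (suc e) j e+j≡k)
      (trans (total-extend (south-V (suc d) j (bound e (shift e e+j≡k)))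
                           (paths (suc d) e (suc j) (shift e e+j≡k)))
        (trans (*-identityˡ _) (total-paths (suc d) e (suc j) (shift e e+j≡k)))))

  -- Read backwards, a south step stays in `Above`. An east step at level at least 1 has weight
  -- zero; one with index above k comes from a vertex with the same index, whose column is then also
  -- beyond k. So `Above` lasts until a zero weight occurs, which must happen before column k is
  -- reached.
  Above⇒weight≈0 : ∀ {f : ℕ → Vertex} (st : ∀ m → Step (f (suc m)) (f m)) M →
    (∀ m → M ≤ m → column (f m) ≡ k) → Above (f 0) → prefixWeight st M ≈ 0#
  Above⇒weight≈0 st zero    col≡k (k<i , _) =
    ⊥-elim (ℕ.<-irrefl (≡.sym (col≡k 0 z≤n)) k<i)
  Above⇒weight≈0 {f} st (suc M) col≡k (k<i , high) = go (st 0) high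
    where
    tail≈0 : Above (f 1) → prefixWeight (st ∘ suc) M ≈ 0#
    tail≈0 = Above⇒weight≈0 (st ∘ suc) M (λ m M≤m → col≡k (suc m) (s≤s M≤m))
    w₁-high : ∀ t i j → 0 ℕ.< t → w₁ t i j ≈ 0#
    w₁-high (suc t) i j _ = refl
    go : (s : Step (f 1) (f 0)) → 0 ℕ.< level (f 0) ⊎ k ℕ.< toℕ (index (f 0)) →
         stepWeight w₁ s * prefixWeight (st ∘ suc) M ≈ 0#
    go (south eq) high = trans
      (*-congˡ (tail≈0 (≡.subst Above (≡.sym eq) (above-Above (k<i , high))))) (zeroʳ _)
    go (east eq) (inj₁ 0<t) = trans (*-congʳ (w₁-high (level (f 1)) (column (f 1)) (index (f 1))
      (≡.subst (0 ℕ.<_) (≡.cong level eq) 0<t))) (zeroˡ _)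
    go (east eq) (inj₂ k<j) = trans (*-congˡ (tail≈0
      (ℕ.<-≤-trans k<j′ (ℕ.≤-pred (toℕ<n (index (f 1)))) , inj₂ k<j′))) (zeroʳ _)
      where
      k<j′ : k ℕ.< toℕ (index (f 1))
      k<j′ = ≡.subst (k ℕ.<_)
        (≡.trans (≡.cong (λ u → toℕ (index u)) eq) (toℕ-inject₁ (index (f 1)))) k<j

  -- Tracing the path backwards follows the recursion of `paths`. The only step without a branch
  -- there is the south step that arrives at index k outside column k; it starts in `Above`, so the
  -- rest of the path has weight zero.
  listed-or-zero : ∀ {f : ℕ → Vertex} (st : ∀ m → Step (f (suc m)) (f m)) M →
    (∀ m → M ≤ m → column (f m) ≡ k) →
    ∀ d e j (e+j≡k : e ℕ.+ j ≡ k) → f 0 ≡ V d j (bound e e+j≡k) →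
    Listed f d e j e+j≡k ⊎ prefixWeight st M ≈ 0#
  listed-or-zero {f} st M col≡k zero e j e+j≡k f0≡ = inj₁ (here λ m →
    ≡.trans (limit-start⇒climb st (λ m M≤m → ≡.trans (col≡k m M≤m) (≡.sym (≡.cong column f0≡))) m)
            (≡.cong (λ u → climb u m) f0≡))
  listed-or-zero st zero col≡k (suc d) e j e+j≡k f0≡ =
    ⊥-elim (ℕ.m+1+n≢n d {k}
      (≡.trans (ℕ.+-suc d k) (≡.trans (≡.sym (≡.cong column f0≡)) (col≡k 0 z≤n))))
  listed-or-zero {f} st (suc M) col≡k (suc d) e j e+j≡k f0≡ = go (st 0) e e+j≡k f0≡
    where
    tail : ∀ d e j (e+j≡k : e ℕ.+ j ≡ k) → f 1 ≡ V d j (bound e e+j≡k) →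
           Listed (f ∘ suc) d e j e+j≡k ⊎ prefixWeight (st ∘ suc) M ≈ 0#
    tail = listed-or-zero (st ∘ suc) M (λ m M≤m → col≡k (suc m) (s≤s M≤m))
    tail-zero : ∀ {x} → prefixWeight (st ∘ suc) M ≈ 0# → x * prefixWeight (st ∘ suc) M ≈ 0#
    tail-zero eq = trans (*-congˡ eq) (zeroʳ _)
    go : (s : Step (f 1) (f 0)) → ∀ e (e+j≡k : e ℕ.+ j ≡ k) → f 0 ≡ V (suc d) j (bound e e+j≡k) →
         Listed f (suc d) e j e+j≡k ⊎ stepWeight w₁ s * prefixWeight (st ∘ suc) M ≈ 0#
    go (east eq) e e+j≡k f0≡ = Sum.map (viaEast-listed d e j e+j≡k f0≡) tail-zero
      (tail d e j e+j≡k (right-injective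
        (≡.trans (≡.sym eq) (≡.trans f0≡ (right-V d j (bound e e+j≡k))))))
    go (south eq) (suc e) e+j≡k f0≡ = Sum.map (viaSouth-listed d e j e+j≡k f0≡) tail-zero
      (tail (suc d) e (suc j) (shift e e+j≡k)
        (≡.trans eq (≡.trans (≡.cong above f0≡) (≡.sym (above-V (suc d) j (bound e (shift e e+j≡k)))))))
    go (south eq) zero ≡.refl f0≡ = inj₂ (tail-zero (Above⇒weight≈0 (st ∘ suc) M
      (λ m M≤m → col≡k (suc m) (s≤s M≤m))
      (≡.subst Above (≡.sym (≡.trans eq (≡.cong above f0≡))) (above-V-Above d ≡.refl))))

  mixedMoment-is-h : ∀ d → Is-h w₁ (d ℕ.+ k) k (mixedMoment k d)
  mixedMoment-is-h d = record
    { support = paths d k 0 k+0≡k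
    ; unique  = paths-unique d k 0 k+0≡k
    ; outside = λ p p∉ → Sum.[ ⊥-elim ∘ p∉ , id ]′
        (listed-or-zero (SE.step p) (proj₁ (SE.column→k p)) (proj₂ (SE.column→k p))
          d k 0 k+0≡k (SE.vertex-0 p))
    ; value   = total-paths d k 0 k+0≡k
    }
    where
    k+0≡k : k ℕ.+ 0 ≡ k
    k+0≡k = ℕ.+-identityʳ k

proposition4p14 : ∀ {c ℓ₁ ℓ₂ : Level} (K : HeytingField c ℓ₁ ℓ₂)
    (a b q : HeytingField.Carrier K) (gen : Generic K a b q) →
    let open PathSums K
        open LittleQJacobi K a b q gen
    in (∃ λ (σ : ℕ → ℕ → HeytingField.Carrier K) → IsMixedMoments σ)
       × (∀ (σ : ℕ → ℕ → HeytingField.Carrier K) → IsMixedMoments σ →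
          ∀ (n k : ℕ) → k ≤ n → Is-h w₁ n k (σ n k))
proposition4p14 K a b q gen = (σ , σ-isMixedMoments) , λ τ isτ n k k≤n →
  -- `mixedMoment-is-h` gives the path sum for column (n - k) + k, and uniqueness transfers it to
  -- arbitrary mixed moments `τ`.
  ≡.subst (λ n′ → Is-h w₁ n′ k (τ n k)) (ℕ.m∸n+n≡m k≤n)
    (Is-h-resp (sym (mixedMoments-unique τ isτ k≤n)) (mixedMoment-is-h k (n ℕ.∸ k)))
  where
  open FieldNotation K using (_≈_; sym; trans)
  open PathSums K
  open LittleQJacobi K a b q gen
  open MixedMoments K a b q gen
  open PathWeights K a b q gen
  Is-h-resp : ∀ {n k s t} → s ≈ t → Is-h w₁ n k s → Is-h w₁ n k t
  Is-h-resp s≈t h = record { IsFiniteSum h ; value = trans (IsFiniteSum.value h) s≈t }
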